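{- The theory $\mathcal{T_M}^+$ (defined in the context) proves the following mathematical statement. Let $U$ be a map from $X$ to $X$, $\varphi$ a map from $X\times X$ to $\mathbb{R}$, and $(u_n)_{n\in\mathbb{N}}$ a sequence of elements of $X$ such that $\lim_nd(U(u_n),u_n)=0$. Consider $F:=Fix(U)$. If $$\forall k\in\mathbb{N}\,\exists x\in F\,\forall y\in F\left(\varphi(x,x)<\varphi(x,y)+\frac{1}{k+1}\right)$$ then $$\forall k\in\mathbb{N}\,\exists x\in F\,\exists n\in\mathbb{N}\,\forall m\geq n\left(\varphi(x,x)<\varphi(x,u_m)+\frac{1}{k+1}\right).$$
   Context: **The theory $\mathcal{T_M}$** (bounded metric spaces). Language: finite types over base types $0$ (natural numbers) and $X$ (abstract metric space); $1:=0\to0$; classical many-sorted logic; the only primitive relation is $=_0$. Constants: combinators; zero, successor, recursors for G\"odel's primitive recursive functionals (all types); $d$ of type $X\to(X\to1)$; $b$ of type $0$ (a positive bound on the diameter of $X$). Reals are represented by type-$1$ functionals in signed digit representation: to each $\gamma^1$ is associated primitive recursively (in the sense of Kleene) a representation $\gamma_{\mathbb{R}}$ of a real; $=_{\mathbb{R}},\leq_{\mathbb{R}}$ are $\Pi^0_1$ and $<_{\mathbb{R}}$ is $\Sigma^0_1$. $\gamma_{[0,1]}:=\max_{\mathbb{R}}(0_{\mathbb{R}},\min_{\mathbb{R}}(1_{\mathbb{R}},\gamma_{\mathbb{R}}))$, with a fixed $l^1$ such that $\gamma_{[0,1]}(n)\leq l(n)$ always; $\forall\gamma\in[0,1](\ldots\gamma\ldots)$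 stands for $\forall\gamma^1(\ldots\gamma_{[0,1]}\ldots)$, dually for $\exists$. $x=_Xy$ abbreviates $d(x,y)=_{\mathbb{R}}0_{\mathbb{R}}$. Axioms: the usual axioms for combinators and arithmetic constants (full induction scheme); Spector's weak (quantifier-free) extensionality rule; $\forall x^X,y^X\forall n^0(d(x,y)(n)=_0d(x,y)_{\mathbb{R}}(n))$; $d(x,x)=_{\mathbb{R}}0_{\mathbb{R}}$; $d(x,y)=_{\mathbb{R}}d(y,x)$; $d(x,z)\leq_{\mathbb{R}}d(x,y)+d(y,z)$; $d(x,y)\leq_{\mathbb{R}}b_{\mathbb{R}}$. **The theory $\mathcal{T_M}^+$.** Bounded formulas are built from atomic formulas by propositional connectives and the bounded quantifications $\forall k\leq_0n$, $\exists k\leq_0n$, $\forall x^X$, $\exists x^X$, $\forall\gamma\in[0,1]$, $\exists\gamma\in[0,1]$. A $\Sigma$-formula has the form $\exists n^0B(n)$ with $B$ bounded. For $f$ of type $1$, $\tilde f(n):=\max_{k\leq n}f(k)$. $\mathcal{T_M}^+$ is $\mathcal{T_M}$ plus, for all $\Sigma$-formulas $A$ (possibly with parameters): bounded choice $\forall n^0\exists k^0A(n,k)\to\exists f^1\forall n\exists k\leq\tilde f(n)A(n,k)$; and bounded collection $\forall i\leq_0m\exists n^0A(i,n)\to\exists n\forall i\leq m\exists k\leq nA(i,k)$, $\forall\gamma\in[0,1]\exists n^0A(\gamma,n)\to\exists n\forall\gamma\in[0,1]\exists k\leq nA(\gamma,k)$, $\forall x^X\exists n^0A(x,n)\to\exists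 n\forall x^X\exists k\leq nA(x,k)$. The mathematical statement is understood as formalized in this language: $U$ is a variable of type $X\to X$, $(u_n)$ of type $0\to X$, $\varphi$ of type $X\to(X\to1)$ (real-valued via representations); $x\in Fix(U)$ means $U(x)=_Xx$; $\lim_nd(U(u_n),u_n)=0$ means $\forall r\exists n\forall m\geq n\,(d(U(u_m),u_m)\leq\frac{1}{r+1})$; no extensionality or continuity of $U$, $\varphi$ is assumed. -}

module Defs where

open import Data.List.Base using (List; []; _∷_; map)
open import Data.List.Membership.Propositional using (_∈_)
open import Data.List.Relation.Unary.Any using (here; there)
open import Data.Maybe.Base using (Maybe; just; nothing; fromMaybe; maybe′; zipWith)
open import Relation.Binary.PropositionalEquality.Core using (refl)

infixr 6 _⇒_
infixl 9 _·_
infix  10 _ʀ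
infix  8 ¬̇_
infixl 7 _+̇_ _∸̇_ _+ʀ_
infix  5 _≐_ _≤̇_ _≤ʀ_ _<ʀ_ _=ʀ_ _=ˣ_ _∈Fix_
infixr 4 _∧̇_
infixr 3 _∨̇_
infixr 2 _⇒̇_
infix  1 _∣_⊢_

------------------------------------------------------------------------
-- Finite types and terms

data Ty : Set where
  ι X : Ty
  _⇒_ : Ty → Ty → Ty

𝟏 : Ty
𝟏 = ι ⇒ ι

Ctx : Set
Ctx = List Ty

data Const : Ty → Set where
  Π    : ∀ {σ τ} → Const (σ ⇒ τ ⇒ σ)
  Σ    : ∀ {ρ σ τ} → Const ((ρ ⇒ σ ⇒ τ) ⇒ (ρ ⇒ σ) ⇒ ρ ⇒ τ)
  zer  : Const ι
  succ : Const (ι ⇒ ι)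
  rec  : ∀ {σ} → Const (ι ⇒ σ ⇒ (σ ⇒ ι ⇒ σ) ⇒ σ)
  dist : Const (X ⇒ X ⇒ 𝟏)
  bnd  : Const ι

-- De Bruijn style: the variable most recently bound is the head of the context.
data Term (Γ : Ctx) : Ty → Set where
  var : ∀ {σ} → σ ∈ Γ → Term Γ σ
  con : ∀ {σ} → Const σ → Term Γ σ
  _·_ : ∀ {σ τ} → Term Γ (σ ⇒ τ) → Term Γ σ → Term Γ τ

Closed : Ty → Set
Closed σ = ∀ {Γ} → Term Γ σ

Ren Sub : Ctx → Ctx → Set
Ren Γ Δ = ∀ {σ} → σ ∈ Γ → σ ∈ Δ
Sub Γ Δ = ∀ {σ} → σ ∈ Γ → Term Δ σ

renᵗ : ∀ {Γ Δ} → Ren Γ Δ → ∀ {σ} → Term Γ σ → Term Δ σ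
renᵗ ρ (var x) = var (ρ x)
renᵗ ρ (con c) = con c
renᵗ ρ (t · s) = renᵗ ρ t · renᵗ ρ s

subᵗ : ∀ {Γ Δ} → Sub Γ Δ → ∀ {σ} → Term Γ σ → Term Δ σ
subᵗ θ (var x) = θ x
subᵗ θ (con c) = con c
subᵗ θ (t · s) = subᵗ θ t · subᵗ θ s

wkᵗ : ∀ {Γ σ τ} → Term Γ τ → Term (σ ∷ Γ) τ
wkᵗ = renᵗ there

ren↑ : ∀ {Γ Δ σ} → Ren Γ Δ → Ren (σ ∷ Γ) (σ ∷ Δ)
ren↑ ρ (here p)  = here p
ren↑ ρ (there x) = there (ρ x)

sub↑ : ∀ {Γ Δ σ} → Sub Γ Δ → Sub (σ ∷ Γ) (σ ∷ Δ)
sub↑ θ (here p)  = var (here p)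
sub↑ θ (there x) = wkᵗ (θ x)

single : ∀ {Γ σ} → Term Γ σ → Sub (σ ∷ Γ) Γ
single t (here refl) = t
single t (there x)   = var x

_[_]ᵗ : ∀ {Γ σ τ} → Term (σ ∷ Γ) τ → Term Γ σ → Term Γ τ
r [ t ]ᵗ = subᵗ (single t) r

v0 : ∀ {Γ a} → Term (a ∷ Γ) a
v0 = var (here refl)

v1 : ∀ {Γ a b} → Term (a ∷ b ∷ Γ) b
v1 = wkᵗ v0

v2 : ∀ {Γ a b c} → Term (a ∷ b ∷ c ∷ Γ) c
v2 = wkᵗ v1

v3 : ∀ {Γ a b c d} → Term (a ∷ b ∷ c ∷ d ∷ Γ) d
v3 = wkᵗ v2

v4 : ∀ {Γ a b c d e} → Term (a ∷ b ∷ c ∷ d ∷ e ∷ Γ) e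
v4 = wkᵗ v3

v5 : ∀ {Γ a b c d e f} → Term (a ∷ b ∷ c ∷ d ∷ e ∷ f ∷ Γ) f
v5 = wkᵗ v4

-- λ-abstraction is not primitive: ƛ is bracket abstraction into the
-- combinators.  It produces Π · t whenever the abstracted variable is not in t,
-- and it performs η-contraction.
strengthen : ∀ {Γ σ τ} → Term (σ ∷ Γ) τ → Maybe (Term Γ τ)
strengthen (var (here _))  = nothing
strengthen (var (there x)) = just (var x)
strengthen (con c)         = just (con c)
strengthen (t · s)         = zipWith _·_ (strengthen t) (strengthen s)

I : ∀ {σ} → Closed (σ ⇒ σ)
I {σ} = con Σ · con Π · con (Π {σ} {σ})

ƛ : ∀ {Γ σ τ} → Term (σ ∷ Γ) τ → Term Γ (σ ⇒ τ)
ƛ (var (here refl))     = I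
ƛ (var (there x))       = con Π · var x
ƛ (con c)               = con Π · con c
ƛ (t · var (here refl)) = fromMaybe (con Σ · ƛ t · I) (strengthen t)
ƛ (t · s)               = maybe′ (con Π ·_) (con Σ · ƛ t · ƛ s) (strengthen (t · s))

------------------------------------------------------------------------
-- Arithmetic on type 0

0̇ : Closed ι
0̇ = con zer

Ṡ : ∀ {Γ} → Term Γ ι → Term Γ ι
Ṡ t = con succ · t

1̇ 2̇ : Closed ι
1̇ = Ṡ 0̇
2̇ = Ṡ 1̇

plus monus maximum : Closed (ι ⇒ ι ⇒ ι)
pred half : Closed (ι ⇒ ι)

plus = ƛ (ƛ (con rec · v0 · v1 · ƛ (ƛ (Ṡ v1))))

pred = ƛ (con rec · v0 · 0̇ · ƛ (ƛ v0))

monus = ƛ (ƛ (con rec · v0 · v1 · ƛ (ƛ (pred · v1))))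

_+̇_ _∸̇_ : ∀ {Γ} → Term Γ ι → Term Γ ι → Term Γ ι
s +̇ t = plus · s · t
s ∸̇ t = monus · s · t

maximum = ƛ (ƛ (v1 +̇ (v0 ∸̇ v1)))

-- ⌊n/2⌋, from ⌊(n+1)/2⌋ = n ∸ ⌊n/2⌋.
half = ƛ (con rec · v0 · 0̇ · ƛ (ƛ (v0 ∸̇ v1)))

-- f̃ (n) = max of f (k) over k ≤ n
tilde : Closed (𝟏 ⇒ 𝟏)
tilde = ƛ (ƛ (con rec · v0 · (v1 · 0̇) · ƛ (ƛ (maximum · v1 · (v3 · Ṡ v0)))))

-- Characteristic functions with value 1 for true and 0 for false.
isZero : ∀ {Γ} → Term Γ ι → Term Γ ι
isZero t = 1̇ ∸̇ t

leq : ∀ {Γ} → Term Γ ι → Term Γ ι → Term Γ ι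
leq s t = isZero (s ∸̇ t)

------------------------------------------------------------------------
-- Real numbers in signed digit representation
--
-- γ of type 1 represents  (γ(0) − γ(1)) + Σ_{i≥1} e_i / 2^i,  where the digit
-- e_i is -1, 0 or 1 according to whether γ(i+1) is 0, 1 or at least 2.

-- stream p q f  is the sequence  p ∸ q, q ∸ p, f(0), f(1), f(2), …
stream : Closed (ι ⇒ ι ⇒ 𝟏 ⇒ 𝟏)
stream =
  ƛ (ƛ (ƛ (ƛ (con rec · v0 · (v3 ∸̇ v2)
                · ƛ (ƛ (con rec · v0 · (v4 ∸̇ v5)
                          · ƛ (ƛ (v5 · v0))))))))

-- γ ↦ γ_ℝ: at most one of the two slots of the integer part is nonzero, and
-- every digit code is at most 2.
canon : Closed (𝟏 ⇒ 𝟏)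
canon = ƛ (stream · (v0 · 0̇) · (v0 · 1̇)
                  · ƛ (2̇ ∸̇ (2̇ ∸̇ (v1 · Ṡ (Ṡ v0)))))

_ʀ : ∀ {Γ} → Term Γ 𝟏 → Term Γ 𝟏
γ ʀ = canon · γ

-- pos γ n − neg γ n = 2^n (γ(0) − γ(1) + Σ_{1≤i≤n} e_i / 2^i)  is an integer at
-- distance at most 1 from 2^n times the real represented by γ.
pos neg : Closed (𝟏 ⇒ ι ⇒ ι)
pos = ƛ (ƛ (con rec · v0 · (v1 · 0̇)
              · ƛ (ƛ (v1 +̇ v1 +̇ leq 2̇ (v3 · Ṡ (Ṡ v0))))))
neg = ƛ (ƛ (con rec · v0 · (v1 · 1̇)
              · ƛ (ƛ (v1 +̇ v1 +̇ isZero (v3 · Ṡ (Ṡ v0))))))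

-- The signed digit representation with  pos − neg = p − q,  for p and q such
-- that  (p − q)(n+1) − 2 (p − q)(n)  is always -1, 0 or 1.
fromApprox : Closed (𝟏 ⇒ 𝟏 ⇒ 𝟏)
fromApprox =
  ƛ (ƛ (stream · (v1 · 0̇) · (v0 · 0̇)
          · ƛ ((1̇ +̇ v2 · Ṡ v0 +̇ v1 · v0 +̇ v1 · v0)
                 ∸̇ (v1 · Ṡ v0 +̇ v2 · v0 +̇ v2 · v0))))

-- max (z, z′) = z′ + (z ∸ z′)  and  min (z, z′) = z − (z ∸ z′), applied to the
-- integer approximations; both preserve the digit condition above.
excess : Closed (𝟏 ⇒ 𝟏 ⇒ 𝟏)
excess = ƛ (ƛ (ƛ ((pos · v2 · v0 +̇ neg · v1 · v0) ∸̇ (pos · v1 · v0 +̇ neg · v2 · v0))))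

maxʀ minʀ : Closed (𝟏 ⇒ 𝟏 ⇒ 𝟏)
maxʀ = ƛ (ƛ (fromApprox · ƛ (pos · v1 · v0 +̇ excess · v2 · v1 · v0) · (neg · v0)))
minʀ = ƛ (ƛ (fromApprox · (pos · v1) · ƛ (neg · v2 · v0 +̇ excess · v2 · v1 · v0)))

natʀ : Closed (ι ⇒ 𝟏)
natʀ = ƛ (stream · v0 · 0̇ · ƛ 1̇)

-- Binary long division of 1 by r+1: the remainders satisfy ρ(0) = 1 and
-- ρ(n+1) = 2ρ(n) − (r+1) or 2ρ(n), according to whether r+1 ≤ 2ρ(n).  The
-- integer part is always 0; for r = 0 this gives 0.111… = 1.
remainder : Closed (ι ⇒ 𝟏)
remainder =
  ƛ (ƛ (con rec · v0 · 1̇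
          · ƛ (ƛ (con rec · leq (Ṡ v3) (v1 +̇ v1) · (v1 +̇ v1)
                    · ƛ (ƛ ((v3 +̇ v3) ∸̇ Ṡ v5))))))

recip : Closed (ι ⇒ 𝟏)
recip = ƛ (stream · 0̇ · 0̇
             · ƛ (1̇ +̇ leq (Ṡ v1) (remainder · v1 · v0 +̇ remainder · v1 · v0)))

-- Carry-free addition.  Let s(k) in {0,…,4} be the sum of the codes of the
-- (k+1)-st digits, so that s(k) − 2 is the sum of these digits, and let
--   c(k) = ⌊(s(k) + [2 ≤ s(k+1)]) / 2⌋ in {0,1,2}.
-- Then c(k) − 1 is the transfer into the next more significant position, and
-- the digit (s(k) − 2) − 2 (c(k) − 1) + (c(k+1) − 1), whose code is
-- s(k) + c(k+1) − 2 c(k), lies in {-1,0,1}.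
digitSum : Closed (𝟏 ⇒ 𝟏 ⇒ 𝟏)
digitSum = ƛ (ƛ (ƛ (v2 · Ṡ (Ṡ v0) +̇ v1 · Ṡ (Ṡ v0))))

carry : Closed (𝟏 ⇒ 𝟏)
carry = ƛ (ƛ (half · (v1 · v0 +̇ leq 2̇ (v1 · Ṡ v0))))

newDigit : Closed (𝟏 ⇒ 𝟏 ⇒ 𝟏)
newDigit = ƛ (ƛ (ƛ ((v2 · v0 +̇ v1 · Ṡ v0) ∸̇ (v1 · v0 +̇ v1 · v0))))

-- The arguments are γ, δ, s and c; carry c(0) goes into the integer part.
addWith : Closed (𝟏 ⇒ 𝟏 ⇒ 𝟏 ⇒ 𝟏 ⇒ 𝟏)
addWith = ƛ (ƛ (ƛ (ƛ (stream
  · (v3 · 0̇ +̇ v2 · 0̇ +̇ v0 · 0̇)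
  · (v3 · 1̇ +̇ v2 · 1̇ +̇ 1̇)
  · (newDigit · v1 · v0)))))

addCanon addʀ : Closed (𝟏 ⇒ 𝟏 ⇒ 𝟏)
addCanon = ƛ (ƛ (addWith · v1 · v0 · (digitSum · v1 · v0) · (carry · (digitSum · v1 · v0))))
addʀ = ƛ (ƛ (addCanon · (v1 ʀ) · (v0 ʀ)))

_+ʀ_ : ∀ {Γ} → Term Γ 𝟏 → Term Γ 𝟏 → Term Γ 𝟏
s +ʀ t = addʀ · s · t

0ʀ 1ʀ : Closed 𝟏
0ʀ = natʀ · 0̇
1ʀ = natʀ · 1̇

1/suc : ∀ {Γ} → Term Γ ι → Term Γ 𝟏
1/suc r = recip · r

-- γ ↦ γ_[0,1].  All values of clamp γ are at most 2, so that the constant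
-- function 2 can serve as the fixed bound on representations of [0,1].
clamp : Closed (𝟏 ⇒ 𝟏)
clamp = ƛ (maxʀ · 0ʀ · (minʀ · 1ʀ · (v0 ʀ)))

------------------------------------------------------------------------
-- Formulas

data Formula (Γ : Ctx) : Set where
  _≐_         : Term Γ ι → Term Γ ι → Formula Γ
  ⊥̇           : Formula Γ
  _∧̇_ _∨̇_ _⇒̇_ : Formula Γ → Formula Γ → Formula Γ
  ∀̇ ∃̇         : (σ : Ty) → Formula (σ ∷ Γ) → Formula Γ

ren : ∀ {Γ Δ} → Ren Γ Δ → Formula Γ → Formula Δ
ren ρ (s ≐ t)  = renᵗ ρ s ≐ renᵗ ρ t
ren ρ ⊥̇        = ⊥̇
ren ρ (A ∧̇ B)  = ren ρ A ∧̇ ren ρ B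
ren ρ (A ∨̇ B)  = ren ρ A ∨̇ ren ρ B
ren ρ (A ⇒̇ B)  = ren ρ A ⇒̇ ren ρ B
ren ρ (∀̇ σ A)  = ∀̇ σ (ren (ren↑ ρ) A)
ren ρ (∃̇ σ A)  = ∃̇ σ (ren (ren↑ ρ) A)

sub : ∀ {Γ Δ} → Sub Γ Δ → Formula Γ → Formula Δ
sub θ (s ≐ t)  = subᵗ θ s ≐ subᵗ θ t
sub θ ⊥̇        = ⊥̇
sub θ (A ∧̇ B)  = sub θ A ∧̇ sub θ B
sub θ (A ∨̇ B)  = sub θ A ∨̇ sub θ B
sub θ (A ⇒̇ B)  = sub θ A ⇒̇ sub θ B
sub θ (∀̇ σ A)  = ∀̇ σ (sub (sub↑ θ) A)
sub θ (∃̇ σ A)  = ∃̇ σ (sub (sub↑ θ) A)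

wk : ∀ {Γ σ} → Formula Γ → Formula (σ ∷ Γ)
wk = ren there

_[_] : ∀ {Γ σ} → Formula (σ ∷ Γ) → Term Γ σ → Formula Γ
A [ t ] = sub (single t) A

-- Replace the innermost variable z by t(z).
instantiate : ∀ {Γ σ} → Term (σ ∷ Γ) σ → Sub (σ ∷ Γ) (σ ∷ Γ)
instantiate t (here refl) = t
instantiate t (there x)   = var (there x)

¬̇_ : ∀ {Γ} → Formula Γ → Formula Γ
¬̇ A = A ⇒̇ ⊥̇

_≤̇_ : ∀ {Γ} → Term Γ ι → Term Γ ι → Formula Γ
s ≤̇ t = s ∸̇ t ≐ 0̇

∀≤ ∃≤ : ∀ {Γ} → Term Γ ι → Formula (ι ∷ Γ) → Formula Γ
∀≤ n A = ∀̇ ι (v0 ≤̇ wkᵗ n ⇒̇ A)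
∃≤ n A = ∃̇ ι (v0 ≤̇ wkᵗ n ∧̇ A)

∀₀₁ ∃₀₁ : ∀ {Γ} → Formula (𝟏 ∷ Γ) → Formula Γ
∀₀₁ A = ∀̇ 𝟏 (sub (instantiate (clamp · v0)) A)
∃₀₁ A = ∃̇ 𝟏 (sub (instantiate (clamp · v0)) A)

-- s_n ≤ t_n + 2, where s_n and t_n are the integer approximations of 2^n s and
-- 2^n t.  This holds for all n iff the real s is at most the real t.
leqAt : ∀ {Γ} → Term Γ 𝟏 → Term Γ 𝟏 → Term Γ ι → Formula Γ
leqAt s t n = pos · s · n +̇ neg · t · n ≤̇ pos · t · n +̇ neg · s · n +̇ 2̇

ltAt : ∀ {Γ} → Term Γ 𝟏 → Term Γ 𝟏 → Term Γ ι → Formula Γ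
ltAt s t n = Ṡ (pos · s · n +̇ neg · t · n +̇ 2̇) ≤̇ pos · t · n +̇ neg · s · n

_≤ʀ_ _<ʀ_ _=ʀ_ : ∀ {Γ} → Term Γ 𝟏 → Term Γ 𝟏 → Formula Γ
s ≤ʀ t = ∀̇ ι (leqAt (wkᵗ (s ʀ)) (wkᵗ (t ʀ)) v0)
s <ʀ t = ∃̇ ι (ltAt (wkᵗ (s ʀ)) (wkᵗ (t ʀ)) v0)
s =ʀ t = ∀̇ ι (leqAt (wkᵗ (s ʀ)) (wkᵗ (t ʀ)) v0 ∧̇ leqAt (wkᵗ (t ʀ)) (wkᵗ (s ʀ)) v0)

d : ∀ {Γ} → Term Γ X → Term Γ X → Term Γ 𝟏
d x y = con dist · x · y

-- Only ≐ is primitive; equality at the other types is defined.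
eq : ∀ {Γ} (σ : Ty) → Term Γ σ → Term Γ σ → Formula Γ
eq ι       s t = s ≐ t
eq X       s t = d s t =ʀ 0ʀ
eq (σ ⇒ τ) s t = ∀̇ σ (eq τ (wkᵗ s · v0) (wkᵗ t · v0))

_=ˣ_ : ∀ {Γ} → Term Γ X → Term Γ X → Formula Γ
x =ˣ y = eq X x y

_∈Fix_ : ∀ {Γ} → Term Γ X → Term Γ (X ⇒ X) → Formula Γ
x ∈Fix U = U · x =ˣ x

∀∈Fix ∃∈Fix : ∀ {Γ} → Term Γ (X ⇒ X) → Formula (X ∷ Γ) → Formula Γ
∀∈Fix U A = ∀̇ X (v0 ∈Fix wkᵗ U ⇒̇ A)
∃∈Fix U A = ∃̇ X (v0 ∈Fix wkᵗ U ∧̇ A)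

∀≥ : ∀ {Γ} → Term Γ ι → Formula (ι ∷ Γ) → Formula Γ
∀≥ n A = ∀̇ ι (wkᵗ n ≤̇ v0 ⇒̇ A)

data QuantifierFree {Γ} : Formula Γ → Set where
  atom : ∀ {s t} → QuantifierFree (s ≐ t)
  bot  : QuantifierFree ⊥̇
  and  : ∀ {A B} → QuantifierFree A → QuantifierFree B → QuantifierFree (A ∧̇ B)
  or   : ∀ {A B} → QuantifierFree A → QuantifierFree B → QuantifierFree (A ∨̇ B)
  imp  : ∀ {A B} → QuantifierFree A → QuantifierFree B → QuantifierFree (A ⇒̇ B)

data Bounded : ∀ {Γ} → Formula Γ → Set where
  atom : ∀ {Γ} {s t : Term Γ ι} → Bounded (s ≐ t)
  bot  : ∀ {Γ} → Bounded {Γ} ⊥̇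
  and  : ∀ {Γ} {A B : Formula Γ} → Bounded A → Bounded B → Bounded (A ∧̇ B)
  or   : ∀ {Γ} {A B : Formula Γ} → Bounded A → Bounded B → Bounded (A ∨̇ B)
  imp  : ∀ {Γ} {A B : Formula Γ} → Bounded A → Bounded B → Bounded (A ⇒̇ B)
  all≤ : ∀ {Γ} {n : Term Γ ι} {A} → Bounded A → Bounded (∀≤ n A)
  ex≤  : ∀ {Γ} {n : Term Γ ι} {A} → Bounded A → Bounded (∃≤ n A)
  allX : ∀ {Γ} {A : Formula (X ∷ Γ)} → Bounded A → Bounded (∀̇ X A)
  exX  : ∀ {Γ} {A : Formula (X ∷ Γ)} → Bounded A → Bounded (∃̇ X A)
  all₀₁ : ∀ {Γ} {A : Formula (𝟏 ∷ Γ)} → Bounded A → Bounded (∀₀₁ A)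
  ex₀₁  : ∀ {Γ} {A : Formula (𝟏 ∷ Γ)} → Bounded A → Bounded (∃₀₁ A)

data IsΣ {Γ} : Formula Γ → Set where
  ex : ∀ {B : Formula (ι ∷ Γ)} → Bounded B → IsΣ (∃̇ ι B)

------------------------------------------------------------------------
-- Derivability

Theory : Set₁
Theory = ∀ {Γ} → Formula Γ → Set

-- Classical natural deduction over non-logical axioms T, with the quantifier-
-- free extensionality rule.  Since contexts are explicit, the convention of
-- many-sorted logic that no sort is empty has to be a rule (inhabited).
data _∣_⊢_ (T : Theory) : ∀ {Γ} → List (Formula Γ) → Formula Γ → Set where
  ax   : ∀ {Γ} {Δ : List (Formula Γ)} {A} → T A → T ∣ Δ ⊢ A
  hyp  : ∀ {Γ} {Δ : List (Formula Γ)} {A} → A ∈ Δ → T ∣ Δ ⊢ A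
  ∧I   : ∀ {Γ} {Δ : List (Formula Γ)} {A B} → T ∣ Δ ⊢ A → T ∣ Δ ⊢ B → T ∣ Δ ⊢ A ∧̇ B
  ∧E₁  : ∀ {Γ} {Δ : List (Formula Γ)} {A B} → T ∣ Δ ⊢ A ∧̇ B → T ∣ Δ ⊢ A
  ∧E₂  : ∀ {Γ} {Δ : List (Formula Γ)} {A B} → T ∣ Δ ⊢ A ∧̇ B → T ∣ Δ ⊢ B
  ∨I₁  : ∀ {Γ} {Δ : List (Formula Γ)} {A B} → T ∣ Δ ⊢ A → T ∣ Δ ⊢ A ∨̇ B
  ∨I₂  : ∀ {Γ} {Δ : List (Formula Γ)} {A B} → T ∣ Δ ⊢ B → T ∣ Δ ⊢ A ∨̇ B
  ∨E   : ∀ {Γ} {Δ : List (Formula Γ)} {A B C} →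
         T ∣ Δ ⊢ A ∨̇ B → T ∣ A ∷ Δ ⊢ C → T ∣ B ∷ Δ ⊢ C → T ∣ Δ ⊢ C
  ⇒I   : ∀ {Γ} {Δ : List (Formula Γ)} {A B} → T ∣ A ∷ Δ ⊢ B → T ∣ Δ ⊢ A ⇒̇ B
  ⇒E   : ∀ {Γ} {Δ : List (Formula Γ)} {A B} → T ∣ Δ ⊢ A ⇒̇ B → T ∣ Δ ⊢ A → T ∣ Δ ⊢ B
  raa  : ∀ {Γ} {Δ : List (Formula Γ)} {A} → T ∣ (¬̇ A) ∷ Δ ⊢ ⊥̇ → T ∣ Δ ⊢ A
  ∀I   : ∀ {Γ} {Δ : List (Formula Γ)} {σ A} → T ∣ map wk Δ ⊢ A → T ∣ Δ ⊢ ∀̇ σ A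
  ∀E   : ∀ {Γ} {Δ : List (Formula Γ)} {σ A} →
         T ∣ Δ ⊢ ∀̇ σ A → (t : Term Γ σ) → T ∣ Δ ⊢ A [ t ]
  ∃I   : ∀ {Γ} {Δ : List (Formula Γ)} {σ A} (t : Term Γ σ) →
         T ∣ Δ ⊢ A [ t ] → T ∣ Δ ⊢ ∃̇ σ A
  ∃E   : ∀ {Γ} {Δ : List (Formula Γ)} {σ A C} →
         T ∣ Δ ⊢ ∃̇ σ A → T ∣ A ∷ map wk Δ ⊢ wk C → T ∣ Δ ⊢ C
  inhabited : ∀ {Γ} {Δ : List (Formula Γ)} (σ : Ty) → T ∣ Δ ⊢ ∃̇ σ (0̇ ≐ 0̇)
  -- The premise of the extensionality rule has no undischarged hypotheses.
  qfExt : ∀ {Γ} {Δ : List (Formula Γ)} {A₀ σ τ} {s t : Term Γ σ} (r : Term (σ ∷ Γ) τ) →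
          QuantifierFree A₀ →
          T ∣ [] ⊢ A₀ ⇒̇ eq σ s t →
          T ∣ Δ ⊢ A₀ ⇒̇ eq τ (r [ s ]ᵗ) (r [ t ]ᵗ)

------------------------------------------------------------------------
-- The theories

-- The equations for Π, Σ and the recursors are stated inside an arbitrary
-- type-0 term p (z), since their two sides may have any type.
data TM : Theory where
  ≐-refl  : ∀ {Γ} {t : Term Γ ι} → TM (t ≐ t)
  ≐-subst : ∀ {Γ} {s t : Term Γ ι} (p q : Term (ι ∷ Γ) ι) →
            TM (s ≐ t ⇒̇ p [ s ]ᵗ ≐ q [ s ]ᵗ ⇒̇ p [ t ]ᵗ ≐ q [ t ]ᵗ)
  Π-eq    : ∀ {Γ σ τ} (p : Term (σ ∷ Γ) ι) (s : Term Γ σ) (t : Term Γ τ) →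
            TM (p [ con Π · s · t ]ᵗ ≐ p [ s ]ᵗ)
  Σ-eq    : ∀ {Γ ρ σ τ} (p : Term (τ ∷ Γ) ι)
            (r : Term Γ (ρ ⇒ σ ⇒ τ)) (s : Term Γ (ρ ⇒ σ)) (t : Term Γ ρ) →
            TM (p [ con Σ · r · s · t ]ᵗ ≐ p [ r · t · (s · t) ]ᵗ)
  rec-zer : ∀ {Γ σ} (p : Term (σ ∷ Γ) ι) (y : Term Γ σ) (z : Term Γ (σ ⇒ ι ⇒ σ)) →
            TM (p [ con rec · 0̇ · y · z ]ᵗ ≐ p [ y ]ᵗ)
  rec-suc : ∀ {Γ σ} (p : Term (σ ∷ Γ) ι)
            (n : Term Γ ι) (y : Term Γ σ) (z : Term Γ (σ ⇒ ι ⇒ σ)) →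
            TM (p [ con rec · Ṡ n · y · z ]ᵗ ≐ p [ z · (con rec · n · y · z) · n ]ᵗ)
  suc≢0   : ∀ {Γ} {t : Term Γ ι} → TM (¬̇ (Ṡ t ≐ 0̇))
  suc-inj : ∀ {Γ} {s t : Term Γ ι} → TM (Ṡ s ≐ Ṡ t ⇒̇ s ≐ t)
  ind     : ∀ {Γ} (A : Formula (ι ∷ Γ)) →
            TM (A [ 0̇ ] ⇒̇ ∀̇ ι (A ⇒̇ sub (instantiate (Ṡ v0)) A) ⇒̇ ∀̇ ι A)
  d-canon : ∀ {Γ} (x y : Term Γ X) (n : Term Γ ι) → TM (d x y · n ≐ (d x y ʀ) · n)
  d-refl  : ∀ {Γ} (x : Term Γ X) → TM (d x x =ʀ 0ʀ)
  d-sym   : ∀ {Γ} (x y : Term Γ X) → TM (d x y =ʀ d y x)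
  d-tri   : ∀ {Γ} (x y z : Term Γ X) → TM (d x z ≤ʀ d x y +ʀ d y z)
  d-bnd   : ∀ {Γ} (x y : Term Γ X) → TM (d x y ≤ʀ natʀ · con bnd)

-- Insert one variable below the two innermost ones.
skip₂ : ∀ {Γ ρ σ τ} → Ren (ρ ∷ σ ∷ Γ) (ρ ∷ σ ∷ τ ∷ Γ)
skip₂ = ren↑ (ren↑ there)

data TM⁺ : Theory where
  base : ∀ {Γ} {A : Formula Γ} → TM A → TM⁺ A
  -- In the following A is A(n,k), A(i,n), A(γ,n), A(x,n) with its second
  -- argument the innermost variable.
  bChoice : ∀ {Γ} (A : Formula (ι ∷ ι ∷ Γ)) → IsΣ A →
    TM⁺ (∀̇ ι (∃̇ ι A) ⇒̇ ∃̇ 𝟏 (∀̇ ι (∃≤ (tilde · v1 · v0) (ren skip₂ A))))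
  bColl-ι : ∀ {Γ} (m : Term Γ ι) (A : Formula (ι ∷ ι ∷ Γ)) → IsΣ A →
    TM⁺ (∀≤ m (∃̇ ι A) ⇒̇ ∃̇ ι (∀≤ (wkᵗ m) (∃≤ v1 (ren skip₂ A))))
  bColl-𝟏 : ∀ {Γ} (A : Formula (ι ∷ 𝟏 ∷ Γ)) → IsΣ A →
    TM⁺ (∀₀₁ (∃̇ ι A) ⇒̇ ∃̇ ι (∀₀₁ (∃≤ v1 (ren skip₂ A))))
  bColl-X : ∀ {Γ} (A : Formula (ι ∷ X ∷ Γ)) → IsΣ A →
    TM⁺ (∀̇ X (∃̇ ι A) ⇒̇ ∃̇ ι (∀̇ X (∃≤ v1 (ren skip₂ A))))

{-# OPTIONS --safe #-}

-- Membership of y in F is  ∀ n B(y, n)  for the bounded formula B(y, n): the n-th dyadic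
-- approximation of d(U y, y) is 0 up to an error of 2 units.  So the hypothesis on x
-- yields  ∀ y ∃ n (B(y, n) → C(y, n)),  where C(y, n) says that n witnesses
-- φ(x, x) < φ(x, y) + 1/(k+1),  and collection over X bounds n by some N uniformly in y.
-- The first N digits of 1/(2^N + 1) vanish, so d(U(u_m), u_m) ≤ 1/(2^N + 1) gives the
-- upper half of B(u_m, n) for all n ≤ N.  The lower half, nonnegativity of d, follows from
-- 0 = d(x, x) ≤ 2 d(x, y), which requires relating the approximations of a sum in signed
-- digit representation to those of its summands.
module Submission where

import Algebra.Solver.CommutativeMonoid.Normal as Normal
open import Algebra.Bundles using (CommutativeMonoid)
import Data.Fin as Fin using (#_)
open import Data.Fin.Base using (Fin; zero; suc)
open import Data.List.Base using (List; []; _∷_; _++_; map)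
open import Data.List.Membership.Propositional using (_∈_)
open import Data.List.Relation.Binary.Subset.Propositional using (_⊆_)
open import Data.List.Relation.Binary.Subset.Propositional.Properties using (map⁺; ∷⁺ʳ)
open import Data.List.Relation.Unary.Any using (here; there)
open import Data.Nat.Base using (ℕ; zero; suc)
open import Data.Nat.Properties using (_<?_)
open import Data.Product.Base using (∃; _,_; proj₁; proj₂)
open import Data.Vec.Base using (Vec; []; _∷_; lookup)
open import Level using (0ℓ)
open import Relation.Binary.PropositionalEquality
  using (_≡_; refl; sym; trans; cong; cong₂; subst; subst₂)
open import Relation.Nullary.Decidable using (True)
open import Defs

variable
  Γ Γ′ Γ″ : Ctx
  Δ Δ′ : List (Formula Γ)
  υ σ τ : Ty

-- Substitution

subᵗ-ext : {θ η : Sub Γ Γ′} → (∀ {σ} (x : σ ∈ Γ) → θ x ≡ η x) →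
           (t : Term Γ τ) → subᵗ θ t ≡ subᵗ η t
subᵗ-ext e (var x) = e x
subᵗ-ext e (con c) = refl
subᵗ-ext e (t · s) = cong₂ _·_ (subᵗ-ext e t) (subᵗ-ext e s)

subᵗ-var : (t : Term Γ τ) → subᵗ var t ≡ t
subᵗ-var (var x) = refl
subᵗ-var (con c) = refl
subᵗ-var (t · s) = cong₂ _·_ (subᵗ-var t) (subᵗ-var s)

subᵗ-ren : (θ : Sub Γ′ Γ″) (r : Ren Γ Γ′) (t : Term Γ τ) →
           subᵗ θ (renᵗ r t) ≡ subᵗ (λ x → θ (r x)) t
subᵗ-ren θ r (var x) = refl
subᵗ-ren θ r (con c) = refl
subᵗ-ren θ r (t · s) = cong₂ _·_ (subᵗ-ren θ r t) (subᵗ-ren θ r s)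

renᵗ-sub : (r : Ren Γ′ Γ″) (θ : Sub Γ Γ′) (t : Term Γ τ) →
           renᵗ r (subᵗ θ t) ≡ subᵗ (λ x → renᵗ r (θ x)) t
renᵗ-sub r θ (var x) = refl
renᵗ-sub r θ (con c) = refl
renᵗ-sub r θ (t · s) = cong₂ _·_ (renᵗ-sub r θ t) (renᵗ-sub r θ s)

subᵗ-sub : (θ : Sub Γ′ Γ″) (η : Sub Γ Γ′) (t : Term Γ τ) →
           subᵗ θ (subᵗ η t) ≡ subᵗ (λ x → subᵗ θ (η x)) t
subᵗ-sub θ η (var x) = refl
subᵗ-sub θ η (con c) = refl
subᵗ-sub θ η (t · s) = cong₂ _·_ (subᵗ-sub θ η t) (subᵗ-sub θ η s)

sub-wkᵗ : (s : Term Γ σ) (t : Term Γ τ) → wkᵗ t [ s ]ᵗ ≡ t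
sub-wkᵗ s t = trans (subᵗ-ren (single s) there t) (subᵗ-var t)

-- Under a binder, the lifted composite agrees with the composite of the lifts only pointwise.
-- Allowing any `ζ` with pointwise agreement lets the induction pass binders without function
-- extensionality.
sub-sub : {η : Sub Γ Γ′} {θ : Sub Γ′ Γ″} {ζ : Sub Γ Γ″} →
          (∀ {σ} (x : σ ∈ Γ) → subᵗ θ (η x) ≡ ζ x) →
          (A : Formula Γ) → sub θ (sub η A) ≡ sub ζ A
sub-sub {Γ} {Γ′} {Γ″} {η} {θ} {ζ} e = go
  where
  onTerm : (t : Term Γ τ) → subᵗ θ (subᵗ η t) ≡ subᵗ ζ t
  onTerm t = trans (subᵗ-sub θ η t) (subᵗ-ext e t)
  under : (x : τ ∈ σ ∷ Γ) → subᵗ (sub↑ θ) (sub↑ η x) ≡ sub↑ ζ x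
  under (here p)  = refl
  under (there x) = trans (subᵗ-ren (sub↑ θ) there (η x))
                          (trans (sym (renᵗ-sub there θ (η x))) (cong wkᵗ (e x)))
  go : (A : Formula Γ) → sub θ (sub η A) ≡ sub ζ A
  go (s ≐ t)  = cong₂ _≐_ (onTerm s) (onTerm t)
  go ⊥̇        = refl
  go (A ∧̇ B)  = cong₂ _∧̇_ (go A) (go B)
  go (A ∨̇ B)  = cong₂ _∨̇_ (go A) (go B)
  go (A ⇒̇ B)  = cong₂ _⇒̇_ (go A) (go B)
  go (∀̇ σ A)  = cong (∀̇ σ) (sub-sub under A)
  go (∃̇ σ A)  = cong (∃̇ σ) (sub-sub under A)

sub-ren : {r : Ren Γ Γ′} {θ : Sub Γ′ Γ″} {ζ : Sub Γ Γ″} →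
          (∀ {σ} (x : σ ∈ Γ) → θ (r x) ≡ ζ x) →
          (A : Formula Γ) → sub θ (ren r A) ≡ sub ζ A
sub-ren {Γ} {r = r} {θ} {ζ} e = go
  where
  onTerm : (t : Term Γ τ) → subᵗ θ (renᵗ r t) ≡ subᵗ ζ t
  onTerm t = trans (subᵗ-ren θ r t) (subᵗ-ext e t)
  under : (x : τ ∈ σ ∷ Γ) → sub↑ θ (ren↑ r x) ≡ sub↑ ζ x
  under (here p)  = refl
  under (there x) = cong wkᵗ (e x)
  go : (A : Formula Γ) → sub θ (ren r A) ≡ sub ζ A
  go (s ≐ t)  = cong₂ _≐_ (onTerm s) (onTerm t)
  go ⊥̇        = refl
  go (A ∧̇ B)  = cong₂ _∧̇_ (go A) (go B)
  go (A ∨̇ B)  = cong₂ _∨̇_ (go A) (go B)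
  go (A ⇒̇ B)  = cong₂ _⇒̇_ (go A) (go B)
  go (∀̇ σ A)  = cong (∀̇ σ) (sub-ren under A)
  go (∃̇ σ A)  = cong (∃̇ σ) (sub-ren under A)

sub-var : {θ : Sub Γ Γ} → (∀ {σ} (x : σ ∈ Γ) → θ x ≡ var x) → (A : Formula Γ) → sub θ A ≡ A
sub-var {Γ} {θ} e = go
  where
  onTerm : (t : Term Γ τ) → subᵗ θ t ≡ t
  onTerm t = trans (subᵗ-ext e t) (subᵗ-var t)
  under : (x : τ ∈ σ ∷ Γ) → sub↑ θ x ≡ var x
  under (here refl) = refl
  under (there x)   = cong wkᵗ (e x)
  go : (A : Formula Γ) → sub θ A ≡ A
  go (s ≐ t)  = cong₂ _≐_ (onTerm s) (onTerm t)
  go ⊥̇        = refl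
  go (A ∧̇ B)  = cong₂ _∧̇_ (go A) (go B)
  go (A ∨̇ B)  = cong₂ _∨̇_ (go A) (go B)
  go (A ⇒̇ B)  = cong₂ _⇒̇_ (go A) (go B)
  go (∀̇ σ A)  = cong (∀̇ σ) (sub-var under A)
  go (∃̇ σ A)  = cong (∃̇ σ) (sub-var under A)

-- Derivations

infix 1 _⊢_

_⊢_ : List (Formula Γ) → Formula Γ → Set
Δ ⊢ A = TM⁺ ∣ Δ ⊢ A

weaken : {A : Formula Γ} → Δ ⊆ Δ′ → Δ ⊢ A → Δ′ ⊢ A
weaken i (ax a)          = ax a
weaken i (hyp x)         = hyp (i x)
weaken i (∧I p q)        = ∧I (weaken i p) (weaken i q)
weaken i (∧E₁ p)         = ∧E₁ (weaken i p)
weaken i (∧E₂ p)         = ∧E₂ (weaken i p)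
weaken i (∨I₁ p)         = ∨I₁ (weaken i p)
weaken i (∨I₂ p)         = ∨I₂ (weaken i p)
weaken i (∨E p q r)      = ∨E (weaken i p) (weaken (∷⁺ʳ _ i) q) (weaken (∷⁺ʳ _ i) r)
weaken i (⇒I p)          = ⇒I (weaken (∷⁺ʳ _ i) p)
weaken i (⇒E p q)        = ⇒E (weaken i p) (weaken i q)
weaken i (raa p)         = raa (weaken (∷⁺ʳ _ i) p)
weaken i (∀I p)          = ∀I (weaken (map⁺ wk i) p)
weaken i (∀E p t)        = ∀E (weaken i p) t
weaken i (∃I t p)        = ∃I t (weaken i p)
weaken i (∃E p q)        = ∃E (weaken i p) (weaken (∷⁺ʳ _ (map⁺ wk i)) q)
weaken i (inhabited σ)   = inhabited σ
-- The premise of this rule is derived from no hypotheses, so it stays as it is.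
weaken i (qfExt r q p)   = qfExt r q p

weaken₁ : {A B : Formula Γ} → Δ ⊢ A → B ∷ Δ ⊢ A
weaken₁ = weaken there

h0 : {A : Formula Γ} → A ∷ Δ ⊢ A
h0 = hyp (here refl)

h1 : {A B : Formula Γ} → B ∷ A ∷ Δ ⊢ A
h1 = weaken₁ h0

h2 : {A B C : Formula Γ} → C ∷ B ∷ A ∷ Δ ⊢ A
h2 = weaken₁ h1

h3 : {A B C D : Formula Γ} → D ∷ C ∷ B ∷ A ∷ Δ ⊢ A
h3 = weaken₁ h2

-- Classically, if no n satisfied A(n) → B(n), then A would hold and B would fail everywhere,
-- against the assumption.
independence-of-premise : {A B : Formula (ι ∷ Γ)} →
  Δ ⊢ ∀̇ ι A ⇒̇ ∃̇ ι B → Δ ⊢ ∃̇ ι (∃̇ ι (wk (A ⇒̇ B)))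
independence-of-premise {Γ} {Δ} {A} {B} p = raa
  (∃E (⇒E (weaken₁ p) (∀I (raa (⇒E h1 (witness (⇒I (raa (⇒E h2 h1))))))))
    (⇒E h1 (witness (⇒I h1))))
  where
  C : Formula (ι ∷ Γ)
  C = A ⇒̇ B
  witness : {Δ : List (Formula (ι ∷ Γ))} → Δ ⊢ C → Δ ⊢ wk (∃̇ ι (∃̇ ι (wk C)))
  -- `v0` is the actual witness; `0̇` fills the vacuous quantifier.
  witness {Δ} q = ∃I v0 (∃I 0̇ (subst (Δ ⊢_) (sym restore) q))
    where
    restore : sub (single 0̇) (sub (sub↑ (single v0)) (ren (ren↑ (ren↑ there)) (wk C))) ≡ C
    restore = trans (sub-sub (λ _ → refl) _) (trans (sub-ren (λ _ → refl) _)
      (trans (sub-ren (λ { (here refl) → refl ; (there x) → refl }) C) (sub-var (λ _ → refl) C)))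

data Env (Γ : Ctx) : Ctx → Set where
  []  : Env Γ []
  _∷_ : ∀ {Ξ} → Term Γ σ → Env Γ Ξ → Env Γ (σ ∷ Ξ)

look : ∀ {Ξ} → Env Γ Ξ → Sub (Ξ ++ Γ) Γ
look []      x           = var x
look (t ∷ e) (here refl) = t
look (t ∷ e) (there x)   = look e x

∀̇* : ∀ Ξ → Formula (Ξ ++ Γ) → Formula Γ
∀̇* []      A = A
∀̇* (σ ∷ Ξ) A = ∀̇* Ξ (∀̇ σ A)

-- All quantifiers are instantiated by one substitution, innermost term first. Iterating `∀E` would
-- leave substitutions into weakened terms, which do not compute away when the terms are arbitrary.
inst : ∀ {Ξ} {A : Formula (Ξ ++ Γ)} → Δ ⊢ ∀̇* Ξ A → (e : Env Γ Ξ) → Δ ⊢ sub (look e) A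
inst {Δ = Δ} {A = A} p [] = subst (Δ ⊢_) (sym (sub-var (λ _ → refl) A)) p
inst {Δ = Δ} {A = A} p (t ∷ e) =
  subst (Δ ⊢_)
        (sub-sub (λ { (here refl) → refl ; (there x) → sub-wkᵗ t (look e x) }) A)
        (∀E (inst p e) t)

-- Equality and conversion

infix 1 _⊢_≈_

-- Equality at any type is indistinguishability in type-0 contexts, the form in which the axioms for
-- combinators and recursors are stated.
_⊢_≈_ : List (Formula Γ) → Term Γ σ → Term Γ σ → Set
_⊢_≈_ {Γ} {σ} Δ s t = (p : Term (σ ∷ Γ) ι) → Δ ⊢ p [ s ]ᵗ ≐ p [ t ]ᵗ

≐-rfl : {t : Term Γ ι} → Δ ⊢ t ≐ t
≐-rfl = ax (base ≐-refl)

≐-sym : {s t : Term Γ ι} → Δ ⊢ s ≐ t → Δ ⊢ t ≐ s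
≐-sym {Γ} {Δ} {s} {t} p =
  subst (λ u → Δ ⊢ t ≐ u) (sub-wkᵗ t s)
    (⇒E (⇒E (ax (base (≐-subst v0 (wkᵗ s)))) p)
        (subst (λ u → Δ ⊢ s ≐ u) (sym (sub-wkᵗ s s)) ≐-rfl))

≐⇒≈ : {s t : Term Γ ι} → Δ ⊢ s ≐ t → Δ ⊢ s ≈ t
≐⇒≈ {Γ} {Δ} {s} {t} e p =
  subst (λ u → Δ ⊢ u ≐ p [ t ]ᵗ) (sub-wkᵗ t (p [ s ]ᵗ))
    (⇒E (⇒E (ax (base (≐-subst (wkᵗ (p [ s ]ᵗ)) p))) e)
        (subst (λ u → Δ ⊢ u ≐ p [ s ]ᵗ) (sym (sub-wkᵗ s (p [ s ]ᵗ))) ≐-rfl))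

≐-trans : {s t u : Term Γ ι} → Δ ⊢ s ≐ t → Δ ⊢ t ≐ u → Δ ⊢ s ≐ u
≐-trans {Γ} {Δ} {s} {t} {u} p q =
  subst₂ (λ a b → Δ ⊢ a ≐ b) (sub-wkᵗ u s) refl
    (⇒E (⇒E (ax (base (≐-subst (wkᵗ s) v0))) q)
        (subst (λ a → Δ ⊢ a ≐ t) (sym (sub-wkᵗ t s)) p))

≈⇒≐ : {s t : Term Γ ι} → Δ ⊢ s ≈ t → Δ ⊢ s ≐ t
≈⇒≐ e = e v0

≈-rfl : {t : Term Γ σ} → Δ ⊢ t ≈ t
≈-rfl p = ≐-rfl

≈-trans : {s t u : Term Γ σ} → Δ ⊢ s ≈ t → Δ ⊢ t ≈ u → Δ ⊢ s ≈ u
≈-trans e₁ e₂ p = ≐-trans (e₁ p) (e₂ p)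

≈-app : {f g : Term Γ (σ ⇒ τ)} {s t : Term Γ σ} →
        Δ ⊢ f ≈ g → Δ ⊢ s ≈ t → Δ ⊢ f · s ≈ g · t
≈-app {Γ} {σ} {τ} {Δ} {f} {g} {s} {t} e₁ e₂ p =
  -- First the function is replaced in the context p(_ · s), then the argument in p(g · _).
  ≐-trans (subst₂ (λ a b → Δ ⊢ a ≐ b) (onHead f) (onHead g) (e₁ (subᵗ head p)))
          (subst₂ (λ a b → Δ ⊢ a ≐ b) (onArg s) (onArg t) (e₂ (subᵗ arg p)))
  where
  head : Sub (τ ∷ Γ) ((σ ⇒ τ) ∷ Γ)
  head (here refl) = v0 · wkᵗ s
  head (there x)   = var (there x)
  arg : Sub (τ ∷ Γ) (σ ∷ Γ)
  arg (here refl) = wkᵗ g · v0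
  arg (there x)   = var (there x)
  onHead : ∀ h → subᵗ (single h) (subᵗ head p) ≡ p [ h · s ]ᵗ
  onHead h = trans (subᵗ-sub (single h) head p)
    (subᵗ-ext (λ { (here refl) → cong (h ·_) (sub-wkᵗ h s) ; (there x) → refl }) p)
  onArg : ∀ a → subᵗ (single a) (subᵗ arg p) ≡ p [ g · a ]ᵗ
  onArg a = trans (subᵗ-sub (single a) arg p)
    (subᵗ-ext (λ { (here refl) → cong (_· a) (sub-wkᵗ a g) ; (there x) → refl }) p)

-- Reduction of combinator terms

infix 4 _↝_

-- Reductions are data, so that one found for variables can be carried along a substitution by
-- `↝-sub` before it becomes a derivation.
data _↝_ {Γ} : Term Γ σ → Term Γ σ → Set where
  stop   : {t : Term Γ σ} → t ↝ t
  _then_ : {s t u : Term Γ σ} → s ↝ t → t ↝ u → s ↝ u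
  app    : {f g : Term Γ (σ ⇒ τ)} {s t : Term Γ σ} → f ↝ g → s ↝ t → f · s ↝ g · t
  Π↝     : {s : Term Γ σ} {t : Term Γ τ} → con Π · s · t ↝ s
  Σ↝     : {r : Term Γ (υ ⇒ σ ⇒ τ)} {s : Term Γ (υ ⇒ σ)} {t : Term Γ υ} →
           con Σ · r · s · t ↝ r · t · (s · t)
  zer↝   : {y : Term Γ σ} {z : Term Γ (σ ⇒ ι ⇒ σ)} → con rec · 0̇ · y · z ↝ y
  succ↝  : {n : Term Γ ι} {y : Term Γ σ} {z : Term Γ (σ ⇒ ι ⇒ σ)} →
           con rec · Ṡ n · y · z ↝ z · (con rec · n · y · z) · n

↝-sub : {s t : Term Γ σ} (θ : Sub Γ Γ′) → s ↝ t → subᵗ θ s ↝ subᵗ θ t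
↝-sub θ stop       = stop
↝-sub θ (p then q) = ↝-sub θ p then ↝-sub θ q
↝-sub θ (app p q)  = app (↝-sub θ p) (↝-sub θ q)
↝-sub θ Π↝         = Π↝
↝-sub θ Σ↝         = Σ↝
↝-sub θ zer↝       = zer↝
↝-sub θ succ↝      = succ↝

↝-sound : {s t : Term Γ σ} → s ↝ t → Δ ⊢ s ≈ t
↝-sound stop       = ≈-rfl
↝-sound {Δ = Δ} (p then q) = ≈-trans {Δ = Δ} (↝-sound p) (↝-sound q)
↝-sound {Δ = Δ} (app p q)  = ≈-app {Δ = Δ} (↝-sound p) (↝-sound q)
↝-sound Π↝ p       = ax (base (Π-eq p _ _))
↝-sound Σ↝ p       = ax (base (Σ-eq p _ _ _))
↝-sound zer↝ p     = ax (base (rec-zer p _ _))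
↝-sound succ↝ p    = ax (base (rec-suc p _ _ _))

Reduct : Term Γ σ → Set
Reduct t = ∃ (t ↝_)

-- Reduction of f · s for f and s normal; the first argument is fuel.
apply : ℕ → (f : Term Γ (σ ⇒ τ)) (s : Term Γ σ) → Reduct (f · s)
apply zero    f s = f · s , stop
apply (suc k) (con Π · r) s = r , Π↝
apply (suc k) (con Σ · f · g) s =
  let f₁ , p = apply k f s
      g₁ , q = apply k g s
      t  , r = apply k f₁ g₁
  in  t , (Σ↝ then (app p q then r))
apply (suc k) (con rec · con zer · y) z = y , zer↝
apply (suc k) (con rec · (con succ · n) · y) z =
  let y₁ , p = apply k (con rec · n · y) z
      z₁ , q = apply k z y₁
      t  , r = apply k z₁ n
  in  t , (succ↝ then (app (app stop p then q) stop then r))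
apply (suc k) f s = f · s , stop

normalise : (t : Term Γ σ) → Reduct t
normalise (f · s) =
  let f₁ , p = normalise f
      s₁ , q = normalise s
      -- The fuel only limits the search: when it runs out, the term is returned as it stands, which
      -- is still a correct reduct.
      t  , r = apply 1000 f₁ s₁
  in  t , (app p q then r)
normalise t = t , stop

nf : Term Γ σ → Term Γ σ
nf t = proj₁ (normalise t)

-- Normalising before the substitution e keeps its arbitrary terms from blocking reduction.
compute : ∀ {Ξ} (e : Env Γ Ξ) (s t : Term (Ξ ++ Γ) ι) → nf s ≡ nf t →
          Δ ⊢ subᵗ (look e) s ≐ subᵗ (look e) t
compute {Δ = Δ} e s t p = ≐-trans (to-nf s)
  (subst (λ u → Δ ⊢ subᵗ (look e) u ≐ subᵗ (look e) t) (sym p) (≐-sym (to-nf t)))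
  where
  to-nf : ∀ u → Δ ⊢ subᵗ (look e) u ≐ subᵗ (look e) (nf u)
  to-nf u = ≈⇒≐ (↝-sound (↝-sub (look e) (proj₂ (normalise u))))

conv : {s t : Term Γ ι} → nf s ≡ nf t → Δ ⊢ s ≐ t
conv {s = s} {t} p = subst₂ (λ a b → _ ⊢ a ≐ b) (subᵗ-var s) (subᵗ-var t) (compute [] s t p)

congᵗ : (p : Term (ι ∷ Γ) ι) {s t : Term Γ ι} → Δ ⊢ s ≐ t → Δ ⊢ p [ s ]ᵗ ≐ p [ t ]ᵗ
congᵗ p e = ≐⇒≈ e p

cong· : (f : Term Γ (ι ⇒ ι)) {s t : Term Γ ι} → Δ ⊢ s ≐ t → Δ ⊢ f · s ≐ f · t
cong· {Δ = Δ} f e = ≈⇒≐ {Δ = Δ} (≈-app {Δ = Δ} (≈-rfl {t = f}) (≐⇒≈ e))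

cong·₂ : (f : Term Γ (ι ⇒ ι ⇒ ι)) {s s′ t t′ : Term Γ ι} →
         Δ ⊢ s ≐ s′ → Δ ⊢ t ≐ t′ → Δ ⊢ f · s · t ≐ f · s′ · t′
cong·₂ {Δ = Δ} f e₁ e₂ =
  ≈⇒≐ {Δ = Δ} (≈-app {Δ = Δ} (≈-app {Δ = Δ} (≈-rfl {t = f}) (≐⇒≈ e₁)) (≐⇒≈ e₂))

-- Arithmetic of type 0

induct : {A : Formula (ι ∷ Γ)} → Δ ⊢ A [ 0̇ ] →
         A ∷ map wk Δ ⊢ sub (instantiate (Ṡ v0)) A → Δ ⊢ ∀̇ ι A
induct p q = ⇒E (⇒E (ax (base (ind _))) p) (∀I (⇒I q))

byCases : {A : Formula (ι ∷ Γ)} → Δ ⊢ A [ 0̇ ] →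
          map wk Δ ⊢ sub (instantiate (Ṡ v0)) A → Δ ⊢ ∀̇ ι A
byCases p q = induct p (weaken₁ q)

+-identityˡ : (t : Term Γ ι) → Δ ⊢ 0̇ +̇ t ≐ t
+-identityˡ t = inst lemma (t ∷ [])
  where
  lemma : Δ ⊢ ∀̇ ι (0̇ +̇ v0 ≐ v0)
  lemma = induct (conv refl) (≐-trans (conv refl) (cong· (con succ) h0))

+-suc : (s t : Term Γ ι) → Δ ⊢ s +̇ Ṡ t ≐ Ṡ (s +̇ t)
+-suc s t = compute (s ∷ t ∷ []) (v0 +̇ Ṡ v1) (Ṡ (v0 +̇ v1)) refl

suc-+ : (s t : Term Γ ι) → Δ ⊢ Ṡ s +̇ t ≐ Ṡ (s +̇ t)
suc-+ s t = inst lemma (t ∷ s ∷ [])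
  where
  lemma : Δ ⊢ ∀̇ ι (∀̇ ι (Ṡ v1 +̇ v0 ≐ Ṡ (v1 +̇ v0)))
  lemma = ∀I (induct (conv refl) (≐-trans (+-suc _ _)
                (≐-trans (cong· (con succ) h0) (cong· (con succ) (≐-sym (+-suc _ _))))))

+-comm : (s t : Term Γ ι) → Δ ⊢ s +̇ t ≐ t +̇ s
+-comm s t = inst lemma (t ∷ s ∷ [])
  where
  lemma : Δ ⊢ ∀̇ ι (∀̇ ι (v1 +̇ v0 ≐ v0 +̇ v1))
  lemma = ∀I (induct (≐-trans (conv refl) (≐-sym (+-identityˡ _)))
                (≐-trans (+-suc _ _) (≐-trans (cong· (con succ) h0) (≐-sym (suc-+ _ _)))))

+-assoc : (r s t : Term Γ ι) → Δ ⊢ (r +̇ s) +̇ t ≐ r +̇ (s +̇ t)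
+-assoc r s t = inst lemma (t ∷ s ∷ r ∷ [])
  where
  lemma : Δ ⊢ ∀̇ ι (∀̇ ι (∀̇ ι ((v2 +̇ v1) +̇ v0 ≐ v2 +̇ (v1 +̇ v0))))
  lemma = ∀I (∀I (induct (conv refl) (≐-trans (conv refl)
            (≐-trans (cong· (con succ) h0) (conv refl)))))

+-cancelʳ : (r s t : Term Γ ι) → Δ ⊢ s +̇ r ≐ t +̇ r → Δ ⊢ s ≐ t
+-cancelʳ r s t = ⇒E (inst lemma (r ∷ t ∷ s ∷ []))
  where
  lemma : Δ ⊢ ∀̇ ι (∀̇ ι (∀̇ ι (v2 +̇ v0 ≐ v1 +̇ v0 ⇒̇ v2 ≐ v1)))
  lemma = ∀I (∀I (induct
    (⇒I (≐-trans (conv refl) (≐-trans h0 (conv refl))))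
    (⇒I (⇒E (weaken₁ h0) (⇒E (ax (base suc-inj))
      (≐-trans (≐-sym (+-suc _ _)) (≐-trans h0 (+-suc _ _))))))))

-- Linear equations and inequalities between sums

+-commutativeMonoid : List (Formula Γ) → CommutativeMonoid 0ℓ 0ℓ
+-commutativeMonoid {Γ} Δ = record
  { Carrier = Term Γ ι
  ; _≈_     = λ s t → Δ ⊢ s ≐ t
  ; _∙_     = _+̇_
  ; ε       = 0̇
  ; isCommutativeMonoid = record
    { isMonoid = record
      { isSemigroup = record
        { isMagma = record
          { isEquivalence = record { refl = ≐-rfl ; sym = ≐-sym ; trans = ≐-trans }
          ; ∙-cong = cong·₂ plus
          }
        ; assoc = +-assoc
        }
      ; identity = +-identityˡ , λ t → ≐-trans (+-comm t 0̇) (+-identityˡ t)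
      }
    ; comm = +-comm
    }
  }

infix  9 #_
infixr 9 Sˡ_
infixl 7 _⊕_

data Lin (n : ℕ) : Set where
  at  : Fin n → Lin n
  0ˡ  : Lin n
  Sˡ_ : Lin n → Lin n
  _⊕_ : Lin n → Lin n → Lin n

#_ : ∀ m {n} {m<n : True (m <? n)} → Lin n
#_ m {m<n = m<n} = at (Fin.#_ m {m<n = m<n})

⟦_⟧ : ∀ {n} → Lin n → Vec (Term Γ ι) n → Term Γ ι
⟦ at i ⟧  ts = lookup ts i
⟦ 0ˡ ⟧    ts = 0̇
⟦ Sˡ a ⟧  ts = Ṡ (⟦ a ⟧ ts)
⟦ a ⊕ b ⟧ ts = ⟦ a ⟧ ts +̇ ⟦ b ⟧ ts

module _ {Γ} {Δ : List (Formula Γ)} {n} (ts : Vec (Term Γ ι) n) where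

  private module M = Normal (+-commutativeMonoid Δ)

  -- Variable 0 of a monoid expression stands for 1, so a successor becomes a summand and gets a
  -- coefficient like any atom.
  expr : Lin n → M.Expr (suc n)
  expr (at i)  = M.var (suc i)
  expr 0ˡ      = M.id
  expr (Sˡ a)  = M.var zero M.⊕ expr a
  expr (a ⊕ b) = expr a M.⊕ expr b

  coefficients : Lin n → Vec ℕ (suc n)
  coefficients a = M.normalise (expr a)

  linear : ∀ a b → coefficients a ≡ coefficients b → Δ ⊢ ⟦ a ⟧ ts ≐ ⟦ b ⟧ ts
  linear a b e = ≐-trans (≐-sym (sound a)) (≐-trans
      (≐-sym (M.correct (expr a) _))
      (subst (λ v → Δ ⊢ M.⟦ v ⟧⇓ (1̇ ∷ ts) ≐ ⟦ b ⟧ ts) (sym e)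
        (≐-trans (M.correct (expr b) _) (sound b))))
    where
    sound : ∀ a → Δ ⊢ M.⟦ expr a ⟧ (1̇ ∷ ts) ≐ ⟦ a ⟧ ts
    sound (at i)  = ≐-rfl
    sound 0ˡ      = ≐-rfl
    sound (Sˡ a)  = ≐-trans (suc-+ 0̇ _)
                      (cong· (con succ) (≐-trans (+-identityˡ _) (sound a)))
    sound (a ⊕ b) = cong·₂ plus (sound a) (sound b)

0∸ : (t : Term Γ ι) → Δ ⊢ 0̇ ∸̇ t ≐ 0̇
0∸ t = inst lemma (t ∷ [])
  where
  lemma : Δ ⊢ ∀̇ ι (0̇ ∸̇ v0 ≐ 0̇)
  lemma = induct (conv refl) (≐-trans (conv refl) (≐-trans (cong· pred h0) (conv refl)))

suc-∸-suc : (s t : Term Γ ι) → Δ ⊢ Ṡ s ∸̇ Ṡ t ≐ s ∸̇ t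
suc-∸-suc s t = inst lemma (t ∷ s ∷ [])
  where
  lemma : Δ ⊢ ∀̇ ι (∀̇ ι (Ṡ v1 ∸̇ Ṡ v0 ≐ v1 ∸̇ v0))
  lemma = ∀I (induct (conv refl) (≐-trans (conv refl) (≐-trans (cong· pred h0) (conv refl))))

≤-+ : (s t : Term Γ ι) → Δ ⊢ s ≤̇ s +̇ t
≤-+ s t = inst lemma (s ∷ t ∷ [])
  where
  lemma : Δ ⊢ ∀̇ ι (∀̇ ι (v0 ≤̇ v0 +̇ v1))
  lemma = ∀I (induct (0∸ _)
    (≐-trans (cong·₂ monus ≐-rfl (suc-+ _ _)) (≐-trans (suc-∸-suc _ _) h0)))

-- Both sides are the maximum of s and t. This identity expresses truncated subtraction by a linear
-- equation; it is proved by induction on s for all t, with a case distinction on t.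
max-comm : (s t : Term Γ ι) → Δ ⊢ s +̇ (t ∸̇ s) ≐ t +̇ (s ∸̇ t)
max-comm s t = inst lemma (t ∷ s ∷ [])
  where
  lemma : Δ ⊢ ∀̇ ι (∀̇ ι (v1 +̇ (v0 ∸̇ v1) ≐ v0 +̇ (v1 ∸̇ v0)))
  lemma = induct
    (∀I (≐-trans (+-identityˡ _) (≐-trans {t = v0 +̇ 0̇} (conv refl)
      (cong·₂ plus ≐-rfl (≐-sym (0∸ _))))))
    (byCases
      (≐-trans (cong·₂ plus ≐-rfl (0∸ _)) (≐-trans (conv refl) (≐-sym (+-identityˡ _))))
      (≐-trans (cong·₂ plus ≐-rfl (suc-∸-suc _ _))
        (≐-trans (suc-+ _ _)
          (≐-trans (cong· (con succ) (∀E h0 v0))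
            (≐-trans (≐-sym (suc-+ _ _)) (cong·₂ plus ≐-rfl (≐-sym (suc-∸-suc _ _))))))))

≤-total : (s t : Term Γ ι) → Δ ⊢ s ≤̇ t ∨̇ Ṡ t ≤̇ s
≤-total s t = inst lemma (t ∷ s ∷ [])
  where
  lemma : Δ ⊢ ∀̇ ι (∀̇ ι (v1 ≤̇ v0 ∨̇ Ṡ v0 ≤̇ v1))
  lemma = induct
    (∀I (∨I₁ (0∸ _)))
    (byCases
      (∨I₂ (≐-trans (suc-∸-suc _ _) (0∸ _)))
      (∨E (∀E h0 v0)
        (∨I₁ (≐-trans (suc-∸-suc _ _) h0))
        (∨I₂ (≐-trans (suc-∸-suc _ _) h0))))

≤-intro : (w : Term Γ ι) {s t : Term Γ ι} → Δ ⊢ s +̇ w ≐ t → Δ ⊢ s ≤̇ t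
≤-intro w e = ≐-trans (cong·₂ monus ≐-rfl (≐-sym e)) (≤-+ _ w)

-- By `max-comm`, once s ∸ t vanishes, t ∸ s is an exact slack.
≤-elim : {s t : Term Γ ι} → Δ ⊢ s ≤̇ t → Δ ⊢ s +̇ (t ∸̇ s) ≐ t
≤-elim {s = s} {t} h =
  ≐-trans (max-comm s t) (≐-trans (cong·₂ plus ≐-rfl h) (≐-trans (+-comm t 0̇) (+-identityˡ t)))

-- A record, so that the linear expressions a and b can be inferred from the type; `⟦_⟧` is not
-- injective.
record Bound {Γ} (Δ : List (Formula Γ)) {n} (ts : Vec (Term Γ ι) n) (a b : Lin n) : Set where
  constructor bound
  field proof : Δ ⊢ ⟦ a ⟧ ts ≤̇ ⟦ b ⟧ ts

module _ {Γ} {Δ : List (Formula Γ)} {n} {ts : Vec (Term Γ ι) n} where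

  infixl 5 _⊞_

  le : ∀ a b → Δ ⊢ ⟦ a ⟧ ts ≤̇ ⟦ b ⟧ ts → Bound Δ ts a b
  le a b = bound

  eqn : ∀ a b → Δ ⊢ ⟦ a ⟧ ts ≐ ⟦ b ⟧ ts → Bound Δ ts a b
  eqn a b e = bound (≤-intro 0̇ (≐-trans (≐-trans (+-comm _ 0̇) (+-identityˡ _)) e))

  _⊞_ : ∀ {a b a′ b′} → Bound Δ ts a b → Bound Δ ts a′ b′ → Bound Δ ts (a ⊕ a′) (b ⊕ b′)
  _⊞_ {a} {b} {a′} {b′} (bound p) (bound q) = bound (≤-intro (v +̇ w)
    (≐-trans
      (linear (⟦ a ⟧ ts ∷ ⟦ a′ ⟧ ts ∷ v ∷ w ∷ [])
        (# 0 ⊕ # 1 ⊕ (# 2 ⊕ # 3)) (# 0 ⊕ # 2 ⊕ (# 1 ⊕ # 3)) refl)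
      (cong·₂ plus (≤-elim p) (≤-elim q))))
    where
    v w : Term Γ ι
    v = ⟦ b ⟧ ts ∸̇ ⟦ a ⟧ ts
    w = ⟦ b′ ⟧ ts ∸̇ ⟦ a′ ⟧ ts

-- Farkas-style certificate: the sum  l ≤ r  of the hypotheses gives  s ≤ t  with slack w.
linarith : ∀ {n} (ts : Vec (Term Γ ι) n) {l r} → Bound Δ ts l r → ∀ s t w →
           coefficients {Δ = Δ} ts (s ⊕ r ⊕ w) ≡ coefficients {Δ = Δ} ts (t ⊕ l) →
           Δ ⊢ ⟦ s ⟧ ts ≤̇ ⟦ t ⟧ ts
linarith ts {l} {r} (bound p) s t w e = ≤-intro (i +̇ ⟦ w ⟧ ts)
  -- Both sides are compared after adding l, because l + i equals r.
  (+-cancelʳ (⟦ l ⟧ ts) _ _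
    (≐-trans
      (linear (⟦ s ⟧ ts ∷ i ∷ ⟦ w ⟧ ts ∷ ⟦ l ⟧ ts ∷ [])
        (# 0 ⊕ (# 1 ⊕ # 2) ⊕ # 3) (# 0 ⊕ (# 3 ⊕ # 1) ⊕ # 2) refl)
      (≐-trans (cong·₂ plus (cong·₂ plus ≐-rfl (≤-elim p)) ≐-rfl)
        (linear ts (s ⊕ r ⊕ w) (t ⊕ l) e))))
  where
  i : Term _ ι
  i = ⟦ r ⟧ ts ∸̇ ⟦ l ⟧ ts

absurd : {A : Formula Γ} → Δ ⊢ 1̇ ≤̇ 0̇ → Δ ⊢ A
absurd p = raa (weaken₁ (⇒E (ax (base (suc≢0 {t = 0̇}))) (≐-trans (conv refl) p)))

∸-≤ : (s t : Term Γ ι) → Δ ⊢ s ∸̇ t ≤̇ s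
∸-≤ s t = ∨E (≤-total s t)
  (linarith (s ∸̇ t ∷ s ∷ []) (eqn (# 0) 0ˡ h0) (# 0) (# 1) (# 1) refl)
  -- Here t < s, so t ∸ s vanishes and `max-comm` gives t + (s ∸ t) = s.
  (linarith ts
    (eqn (# 1 ⊕ # 2) (# 0 ⊕ # 3) (≐-sym (max-comm s t)) ⊞ eqn (# 3) 0ˡ
      (linarith ts (le (Sˡ # 1) (# 0) h0) (# 1) (# 0) (Sˡ 0ˡ) refl))
    (# 2) (# 0) (# 1) refl)
  where ts = s ∷ t ∷ s ∸̇ t ∷ t ∸̇ s ∷ []

-- Signed digit representations

-- This is min (y, 2), written as in `canon` so that the normal forms match.
clip : Term Γ ι → Term Γ ι
clip y = 2̇ ∸̇ (2̇ ∸̇ y)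

module _ {Γ} {Δ : List (Formula Γ)} where

  pos-zero : (γ : Term Γ 𝟏) → Δ ⊢ pos · γ · 0̇ ≐ γ · 0̇
  pos-zero γ = compute (γ ∷ []) (pos · v0 · 0̇) (v0 · 0̇) refl

  neg-zero : (γ : Term Γ 𝟏) → Δ ⊢ neg · γ · 0̇ ≐ γ · 1̇
  neg-zero γ = compute (γ ∷ []) (neg · v0 · 0̇) (v0 · 1̇) refl

  pos-suc : (γ : Term Γ 𝟏) (n : Term Γ ι) →
    Δ ⊢ pos · γ · Ṡ n ≐ pos · γ · n +̇ pos · γ · n +̇ leq 2̇ (γ · Ṡ (Ṡ n))
  pos-suc γ n = compute (γ ∷ n ∷ [])
    (pos · v0 · Ṡ v1) (pos · v0 · v1 +̇ pos · v0 · v1 +̇ leq 2̇ (v0 · Ṡ (Ṡ v1))) refl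

  neg-suc : (γ : Term Γ 𝟏) (n : Term Γ ι) →
    Δ ⊢ neg · γ · Ṡ n ≐ neg · γ · n +̇ neg · γ · n +̇ isZero (γ · Ṡ (Ṡ n))
  neg-suc γ n = compute (γ ∷ n ∷ [])
    (neg · v0 · Ṡ v1) (neg · v0 · v1 +̇ neg · v0 · v1 +̇ isZero (v0 · Ṡ (Ṡ v1))) refl

  canon-zero : (γ : Term Γ 𝟏) → Δ ⊢ (γ ʀ) · 0̇ ≐ γ · 0̇ ∸̇ γ · 1̇
  canon-zero γ = compute (γ ∷ []) ((v0 ʀ) · 0̇) (v0 · 0̇ ∸̇ v0 · 1̇) refl

  canon-one : (γ : Term Γ 𝟏) → Δ ⊢ (γ ʀ) · 1̇ ≐ γ · 1̇ ∸̇ γ · 0̇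
  canon-one γ = compute (γ ∷ []) ((v0 ʀ) · 1̇) (v0 · 1̇ ∸̇ v0 · 0̇) refl

  canon-digit : (γ : Term Γ 𝟏) (n : Term Γ ι) →
    Δ ⊢ (γ ʀ) · Ṡ (Ṡ n) ≐ clip (γ · Ṡ (Ṡ n))
  canon-digit γ n = compute (γ ∷ n ∷ []) ((v0 ʀ) · Ṡ (Ṡ v1)) (clip (v0 · Ṡ (Ṡ v1))) refl

sums carries : Term Γ 𝟏 → Term Γ 𝟏 → Term Γ 𝟏
sums γ δ    = digitSum · (γ ʀ) · (δ ʀ)
carries γ δ = carry · sums γ δ

-- The two integer slots of the sum before they are reduced against each other. The transfer c(0) -
-- 1 is split: c(0) enters the first slot, 1 the second.
addend₀ addend₁ : Term Γ 𝟏 → Term Γ 𝟏 → Term Γ ι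
addend₀ γ δ = (γ ʀ) · 0̇ +̇ (δ ʀ) · 0̇ +̇ carries γ δ · 0̇
addend₁ γ δ = (γ ʀ) · 1̇ +̇ (δ ʀ) · 1̇ +̇ 1̇

module _ {Γ} {Δ : List (Formula Γ)} (γ δ : Term Γ 𝟏) where

  add-zero : Δ ⊢ (γ +ʀ δ) · 0̇ ≐ addend₀ γ δ ∸̇ addend₁ γ δ
  add-zero = compute (γ ∷ δ ∷ []) ((v0 +ʀ v1) · 0̇) (addend₀ v0 v1 ∸̇ addend₁ v0 v1) refl

  add-one : Δ ⊢ (γ +ʀ δ) · 1̇ ≐ addend₁ γ δ ∸̇ addend₀ γ δ
  add-one = compute (γ ∷ δ ∷ []) ((v0 +ʀ v1) · 1̇) (addend₁ v0 v1 ∸̇ addend₀ v0 v1) refl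

  add-digit : ∀ n → Δ ⊢ (γ +ʀ δ) · Ṡ (Ṡ n) ≐
    (sums γ δ · n +̇ carries γ δ · Ṡ n) ∸̇ (carries γ δ · n +̇ carries γ δ · n)
  add-digit n = compute (γ ∷ δ ∷ n ∷ []) ((v0 +ʀ v1) · Ṡ (Ṡ v2))
    ((sums v0 v1 · v2 +̇ carries v0 v1 · Ṡ v2) ∸̇ (carries v0 v1 · v2 +̇ carries v0 v1 · v2)) refl

  sums-eq : ∀ n → Δ ⊢ sums γ δ · n ≐ (γ ʀ) · Ṡ (Ṡ n) +̇ (δ ʀ) · Ṡ (Ṡ n)
  sums-eq n = compute (γ ∷ δ ∷ n ∷ [])
    (sums v0 v1 · v2) ((v0 ʀ) · Ṡ (Ṡ v2) +̇ (v1 ʀ) · Ṡ (Ṡ v2)) refl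

carry-eq : (s : Term Γ 𝟏) (n : Term Γ ι) → Δ ⊢ carry · s · n ≐ half · (s · n +̇ leq 2̇ (s · Ṡ n))
carry-eq s n = compute (s ∷ n ∷ []) (carry · v0 · v1) (half · (v0 · v1 +̇ leq 2̇ (v0 · Ṡ v1))) refl

half-suc : (t : Term Γ ι) → Δ ⊢ half · Ṡ t ≐ t ∸̇ half · t
half-suc t = compute (t ∷ []) (half · Ṡ v0) (v0 ∸̇ half · v0) refl

pow : Closed 𝟏
pow = ƛ (con rec · v0 · 1̇ · ƛ (ƛ (v1 +̇ v1)))

pow-suc : (n : Term Γ ι) → Δ ⊢ pow · Ṡ n ≐ pow · n +̇ pow · n
pow-suc n = compute (n ∷ []) (pow · Ṡ v0) (pow · v0 +̇ pow · v0) refl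

-- A recursor with constant step is a case distinction between 0 and successors; the doubled `con Π`
-- is what `ƛ` produces for the constant step.
remainder-suc : (r n : Term Γ ι) → let ρ = remainder · r · n in
  Δ ⊢ remainder · r · Ṡ n ≐
      con rec · leq (Ṡ r) (ρ +̇ ρ) · (ρ +̇ ρ) · (con Π · (con Π · ((ρ +̇ ρ) ∸̇ Ṡ r)))
remainder-suc r n = compute (r ∷ n ∷ []) (remainder · v0 · Ṡ v1)
  (con rec · leq (Ṡ v0) (ρ +̇ ρ) · (ρ +̇ ρ) · (con Π · (con Π · ((ρ +̇ ρ) ∸̇ Ṡ v0)))) refl
  where ρ = remainder · v0 · v1

recip-zero : (r : Term Γ ι) → Δ ⊢ ((recip · r) ʀ) · 0̇ ≐ 0̇
recip-zero r = compute (r ∷ []) (((recip · v0) ʀ) · 0̇) 0̇ refl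

recip-digit : (r n : Term Γ ι) → let ρ = remainder · r · n in
  Δ ⊢ ((recip · r) ʀ) · Ṡ (Ṡ n) ≐ clip (1̇ +̇ leq (Ṡ r) (ρ +̇ ρ))
recip-digit r n = compute (r ∷ n ∷ [])
  (((recip · v0) ʀ) · Ṡ (Ṡ v1)) (clip (1̇ +̇ leq (Ṡ v0) (ρ +̇ ρ))) refl
  where ρ = remainder · v0 · v1

-- Estimates for digits and halves

clip-≤ : (y : Term Γ ι) → Δ ⊢ clip y ≤̇ 2̇
clip-≤ y = ∸-≤ 2̇ (2̇ ∸̇ y)

clip-≥2 : (y : Term Γ ι) → Δ ⊢ clip (Ṡ (Ṡ y)) ≐ 2̇
clip-≥2 y = ≐-trans
  (cong·₂ monus ≐-rfl (≐-trans (suc-∸-suc _ _) (≐-trans (suc-∸-suc _ _) (0∸ y))))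
  (conv refl)

-- For the code y of a digit,  leq 2̇ (clip y) − isZero (clip y)  is min (y − 1, 1).
digit-≤ : (y : Term Γ ι) → Δ ⊢ leq 2̇ (clip y) +̇ 1̇ ≤̇ isZero (clip y) +̇ y
digit-≤ y = inst lemma (y ∷ [])
  where
  claim : ∀ {Γ} → Term Γ ι → Formula Γ
  claim t = leq 2̇ (clip t) +̇ 1̇ ≤̇ isZero (clip t) +̇ t
  lemma : Δ ⊢ ∀̇ ι (claim v0)
  -- The codes 0 and 1 are settled by computation; from 2 on, `clip` has the value 2.
  lemma = byCases (conv refl) (∀E {A = claim (Ṡ v0)} (byCases (conv refl)
    (linarith (leq 2̇ (clip (Ṡ (Ṡ v0))) ∷ isZero (clip (Ṡ (Ṡ v0))) ∷ v0 ∷ [])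
      (eqn (# 0) (Sˡ 0ˡ) (≐-trans (congᵗ (leq 2̇ v0) (clip-≥2 v0)) (conv refl)))
      (# 0 ⊕ Sˡ 0ˡ) (# 1 ⊕ Sˡ Sˡ # 2) (# 1 ⊕ # 2) refl)) v0)

digit-≥ : (y : Term Γ ι) → Δ ⊢ isZero (clip y) +̇ clip y ≤̇ leq 2̇ (clip y) +̇ 1̇
digit-≥ y = inst lemma (y ∷ [])
  where
  claim : ∀ {Γ} → Term Γ ι → Formula Γ
  claim t = isZero (clip t) +̇ clip t ≤̇ leq 2̇ (clip t) +̇ 1̇
  lemma : Δ ⊢ ∀̇ ι (claim v0)
  lemma = byCases (conv refl) (∀E {A = claim (Ṡ v0)} (byCases (conv refl)
    (linarith (isZero c ∷ c ∷ leq 2̇ c ∷ [])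
      (eqn (# 0) 0ˡ (≐-trans (congᵗ (isZero v0) (clip-≥2 v0)) (conv refl))
        ⊞ eqn (# 1) (Sˡ Sˡ 0ˡ) (clip-≥2 v0)
        ⊞ eqn (Sˡ 0ˡ) (# 2) (≐-sym (≐-trans (congᵗ (leq 2̇ v0) (clip-≥2 v0)) (conv refl))))
      (# 0 ⊕ # 1) (# 2 ⊕ Sˡ 0ˡ) 0ˡ refl)) v0)
    where
    c : ∀ {Γ} → Term (ι ∷ Γ) ι
    c = clip (Ṡ (Ṡ v0))

-- Induction along ⌊(x+1)/2⌋ = x ∸ ⌊x/2⌋: each of the two bounds for x turns into the other one for
-- x + 1.
half-bounds : (x : Term Γ ι) →
  Δ ⊢ (half · x +̇ half · x ≤̇ x) ∧̇ (x ≤̇ Ṡ (half · x +̇ half · x))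
half-bounds x = inst lemma (x ∷ [])
  where
  step : (x : Term Γ ι) → let h = half · x ; h′ = half · Ṡ x in
         Δ ⊢ h +̇ h ≤̇ x → Δ ⊢ x ≤̇ Ṡ (h +̇ h) →
         Δ ⊢ (h′ +̇ h′ ≤̇ Ṡ x) ∧̇ (Ṡ x ≤̇ Ṡ (h′ +̇ h′))
  step {Δ = Δ} x p q = ∧I
    (linarith ts
      (k≤z ⊞ k≤z ⊞ h+z≤x ⊞ h+z≤x ⊞ le (# 2) (Sˡ (# 0 ⊕ # 0)) q)
      (# 3 ⊕ # 3) (Sˡ # 2) 0ˡ refl)
    (linarith ts
      (z≤k ⊞ z≤k ⊞ x≤h+z ⊞ x≤h+z ⊞ le (# 0 ⊕ # 0) (# 2) p)
      (Sˡ # 2) (Sˡ (# 3 ⊕ # 3)) 0ˡ refl)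
    where
    ts = half · x ∷ x ∸̇ half · x ∷ x ∷ half · Ṡ x ∷ []
    k≤z : Bound Δ ts (# 3) (# 1)
    k≤z = eqn (# 3) (# 1) (half-suc x)
    z≤k : Bound Δ ts (# 1) (# 3)
    z≤k = eqn (# 1) (# 3) (≐-sym (half-suc x))
    h+z≐x : Δ ⊢ half · x +̇ (x ∸̇ half · x) ≐ x
    -- The first bound gives ⌊x/2⌋ ≤ x, so the truncated difference is exact.
    h+z≐x = ≤-elim (linarith ts (le (# 0 ⊕ # 0) (# 2) p) (# 0) (# 2) (# 0) refl)
    h+z≤x : Bound Δ ts (# 0 ⊕ # 1) (# 2)
    h+z≤x = eqn (# 0 ⊕ # 1) (# 2) h+z≐x
    x≤h+z : Bound Δ ts (# 2) (# 0 ⊕ # 1)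
    x≤h+z = eqn (# 2) (# 0 ⊕ # 1) (≐-sym h+z≐x)
  lemma : Δ ⊢ ∀̇ ι ((half · v0 +̇ half · v0 ≤̇ v0) ∧̇ (v0 ≤̇ Ṡ (half · v0 +̇ half · v0)))
  lemma = induct (∧I (conv refl) (conv refl)) (step v0 (∧E₁ h0) (∧E₂ h0))

leq-≤1 : (s t : Term Γ ι) → Δ ⊢ leq s t ≤̇ 1̇
leq-≤1 s t = ∸-≤ 1̇ (s ∸̇ t)

-- For z < 2 the left side is 0. For z ≥ 2 it is at most 1, while half of a number that is at least
-- 2 is at least 1. This bounds a rounding bit by the next carry.
leq-≤-half : (z l : Term Γ ι) → Δ ⊢ leq 2̇ z ≤̇ half · (z +̇ l)
leq-≤-half z l = inst lemma (z ∷ l ∷ [])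
  where
  claim : ∀ {Γ} → Term (ι ∷ ι ∷ Γ) ι → Formula (ι ∷ ι ∷ Γ)
  claim t = leq 2̇ t ≤̇ half · (t +̇ v1)
  small : (k : Term Γ ι) (u : Term Γ ι) → Δ ⊢ leq 2̇ k ≐ 0̇ → Δ ⊢ leq 2̇ k ≤̇ u
  small k u e = linarith (leq 2̇ k ∷ u ∷ []) (eqn (# 0) 0ˡ e) (# 0) (# 1) (# 1) refl
  large : (m l : Term Γ ι) → let x = Ṡ (Ṡ m) +̇ l in
          Δ ⊢ leq 2̇ (Ṡ (Ṡ m)) ≤̇ half · x
  large m l = ∨E (≤-total (leq 2̇ (Ṡ (Ṡ m))) (half · x)) h0
    (absurd (linarith (h ∷ a ∷ m ∷ l ∷ [])
      (le (Sˡ # 0) (# 1) h0 ⊞ le (Sˡ # 0) (# 1) h0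
       ⊞ le (# 1) (Sˡ 0ˡ) (leq-≤1 2̇ _) ⊞ le (# 1) (Sˡ 0ˡ) (leq-≤1 2̇ _)
       ⊞ le (Sˡ Sˡ # 2 ⊕ # 3) (Sˡ (# 0 ⊕ # 0)) (∧E₂ (half-bounds x)))
      (Sˡ 0ˡ) 0ˡ (# 2 ⊕ # 3) refl))
    where
    x a h : Term _ ι
    x = Ṡ (Ṡ m) +̇ l
    a = leq 2̇ (Ṡ (Ṡ m))
    h = half · x
  lemma : Δ ⊢ ∀̇ ι (∀̇ ι (claim v0))
  lemma = ∀I (byCases (small _ _ (conv refl))
    (∀E {A = leq 2̇ (Ṡ v0) ≤̇ half · (Ṡ v0 +̇ v2)}
      (byCases (small _ _ (conv refl)) (large v0 v2)) v0))

canon-digit-≤2 : (γ : Term Γ 𝟏) (n : Term Γ ι) → Δ ⊢ (γ ʀ) · Ṡ (Ṡ n) ≤̇ 2̇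
canon-digit-≤2 γ n = ≐-trans (congᵗ (v0 ∸̇ 2̇) (canon-digit γ n)) (clip-≤ _)

canon-digit-≥ : (γ : Term Γ 𝟏) (n : Term Γ ι) → let e = (γ ʀ) · Ṡ (Ṡ n) in
                Δ ⊢ isZero e +̇ e ≤̇ leq 2̇ e +̇ 1̇
canon-digit-≥ γ n =
  ≐-trans (congᵗ ((isZero v0 +̇ v0) ∸̇ (leq 2̇ v0 +̇ 1̇)) (canon-digit γ n)) (digit-≥ _)

-- Passing to stage n + 1 doubles the approximation and adds the digit, which is at least its code
-- minus 1.
approx-suc-≥ : (γ : Term Γ 𝟏) (n : Term Γ ι) →
  let a = pos · (γ ʀ) · n ; b = neg · (γ ʀ) · n in
  Δ ⊢ neg · (γ ʀ) · Ṡ n +̇ (a +̇ a) +̇ (γ ʀ) · Ṡ (Ṡ n) ≤̇ pos · (γ ʀ) · Ṡ n +̇ (b +̇ b) +̇ 1̇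
approx-suc-≥ γ n = linarith
  (pos · (γ ʀ) · n ∷ neg · (γ ʀ) · n ∷ pos · (γ ʀ) · Ṡ n ∷ neg · (γ ʀ) · Ṡ n ∷
   leq 2̇ e ∷ isZero e ∷ e ∷ [])
  (eqn (# 3) (# 1 ⊕ # 1 ⊕ # 5) (neg-suc _ n)
    ⊞ eqn (# 0 ⊕ # 0 ⊕ # 4) (# 2) (≐-sym (pos-suc _ n))
    ⊞ le (# 5 ⊕ # 6) (# 4 ⊕ Sˡ 0ˡ) (canon-digit-≥ γ n))
  (# 3 ⊕ (# 0 ⊕ # 0) ⊕ # 6) (# 2 ⊕ (# 1 ⊕ # 1) ⊕ Sˡ 0ˡ) 0ˡ refl
  where
  e = (γ ʀ) · Ṡ (Ṡ n)

-- Approximations of a sum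

module _ {Γ} {Δ : List (Formula Γ)} (γ δ : Term Γ 𝟏) (n : Term Γ ι) where

  private
    s c c′ l x y g h : Term Γ ι
    s  = sums γ δ · n
    c  = carries γ δ · n
    c′ = carries γ δ · Ṡ n
    l  = leq 2̇ (sums γ δ · Ṡ n)
    x  = s +̇ l
    y  = (s +̇ c′) ∸̇ (c +̇ c)
    g  = (γ ʀ) · Ṡ (Ṡ n)
    h  = (δ ʀ) · Ṡ (Ṡ n)

  -- Both digit codes are at most 2, so 2c ≤ 4 + 1, which excludes c ≥ 3.
  carry-≤2 : Δ ⊢ c ≤̇ 2̇
  carry-≤2 = ∨E (≤-total c 2̇) h0 (absurd (linarith (c ∷ half · x ∷ s ∷ l ∷ g ∷ h ∷ [])
    (le (Sˡ Sˡ Sˡ 0ˡ) (# 0) h0 ⊞ le (Sˡ Sˡ Sˡ 0ˡ) (# 0) h0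
      ⊞ eqn (# 0) (# 1) (carry-eq _ n) ⊞ eqn (# 0) (# 1) (carry-eq _ n)
      ⊞ le (# 1 ⊕ # 1) (# 2 ⊕ # 3) (∧E₁ (half-bounds x))
      ⊞ le (# 3) (Sˡ 0ˡ) (leq-≤1 2̇ _)
      ⊞ eqn (# 2) (# 4 ⊕ # 5) (sums-eq γ δ n)
      ⊞ le (# 4) (Sˡ Sˡ 0ˡ) (canon-digit-≤2 γ n)
      ⊞ le (# 5) (Sˡ Sˡ 0ˡ) (canon-digit-≤2 δ n))
    (Sˡ 0ˡ) 0ˡ 0ˡ refl))

  -- Since 2c ≤ s + l and l ≤ c′, the truncated subtraction in the digit code y is exact.
  twice-carry-≤ : Δ ⊢ c +̇ c ≤̇ s +̇ c′
  twice-carry-≤ = linarith (c ∷ half · x ∷ s ∷ l ∷ c′ ∷ half · _ ∷ [])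
    (eqn (# 0) (# 1) (carry-eq _ n) ⊞ eqn (# 0) (# 1) (carry-eq _ n)
      ⊞ le (# 1 ⊕ # 1) (# 2 ⊕ # 3) (∧E₁ (half-bounds x))
      ⊞ le (# 3) (# 5) (leq-≤-half _ _)
      ⊞ eqn (# 5) (# 4) (≐-sym (carry-eq _ (Ṡ n))))
    (# 0 ⊕ # 0) (# 2 ⊕ # 4) 0ˡ refl

  private
    W : Term Γ 𝟏
    W = (γ +ʀ δ) ʀ
    W-digit : Δ ⊢ W · Ṡ (Ṡ n) ≐ clip y
    W-digit = ≐-trans (canon-digit _ n) (congᵗ (clip v0) (add-digit γ δ n))

  -- The new digit is at most y - 1 by `digit-≤`, and y = s + c′ - 2c by `twice-carry-≤`.
  add-suc-≤ : let p = pos · W · n ; q = neg · W · n in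
    Δ ⊢ pos · W · Ṡ n +̇ (q +̇ q) +̇ (c +̇ c) +̇ 1̇ ≤̇ neg · W · Ṡ n +̇ (p +̇ p) +̇ (s +̇ c′)
  add-suc-≤ = linarith
    (pos · W · n ∷ neg · W · n ∷ pos · W · Ṡ n ∷ neg · W · Ṡ n ∷
     s ∷ c ∷ c′ ∷ y ∷ leq 2̇ (clip y) ∷ isZero (clip y) ∷ [])
    (eqn (# 2) (# 0 ⊕ # 0 ⊕ # 8)
        (≐-trans (pos-suc W n) (cong·₂ plus ≐-rfl (congᵗ (leq 2̇ v0) W-digit)))
      ⊞ eqn (# 1 ⊕ # 1 ⊕ # 9) (# 3)
        (≐-sym (≐-trans (neg-suc W n) (cong·₂ plus ≐-rfl (congᵗ (isZero v0) W-digit))))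
      ⊞ le (# 8 ⊕ Sˡ 0ˡ) (# 9 ⊕ # 7) (digit-≤ y)
      ⊞ eqn (# 5 ⊕ # 5 ⊕ # 7) (# 4 ⊕ # 6) (≤-elim twice-carry-≤))
    (# 2 ⊕ (# 1 ⊕ # 1) ⊕ (# 5 ⊕ # 5) ⊕ Sˡ 0ˡ) (# 3 ⊕ (# 0 ⊕ # 0) ⊕ (# 4 ⊕ # 6)) 0ˡ refl

-- The approximations of γ + δ at stage n exceed the sum of those of γ and δ by at most
-- the transfer  c − 1  into position n.
addBound : Term Γ 𝟏 → Term Γ 𝟏 → Term Γ ι → Formula Γ
addBound γ δ n =
  pos · ((γ +ʀ δ) ʀ) · n +̇ neg · (γ ʀ) · n +̇ neg · (δ ʀ) · n +̇ 1̇ ≤̇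
  neg · ((γ +ʀ δ) ʀ) · n +̇ pos · (γ ʀ) · n +̇ pos · (δ ʀ) · n +̇ carries γ δ · n

-- Integer parts pass through two truncated differences, in `stream` and in `canon`; two uses of
-- `max-comm` reduce them to p - q.
addBound-zero : (γ δ : Term Γ 𝟏) → Δ ⊢ addBound γ δ 0̇
addBound-zero γ δ = linarith
  (pos · W · 0̇ ∷ neg · W · 0̇ ∷ u ∸̇ v ∷ v ∸̇ u ∷ u ∷ v ∷
   (γ ʀ) · 0̇ ∷ (γ ʀ) · 1̇ ∷ (δ ʀ) · 0̇ ∷ (δ ʀ) · 1̇ ∷
   pos · (γ ʀ) · 0̇ ∷ neg · (γ ʀ) · 0̇ ∷ pos · (δ ʀ) · 0̇ ∷ neg · (δ ʀ) · 0̇ ∷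
   carries γ δ · 0̇ ∷ [])
  (eqn (# 0) (# 2)
      (≐-trans (pos-zero W) (≐-trans (canon-zero _) (cong·₂ monus (add-zero γ δ) (add-one γ δ))))
    ⊞ eqn (# 3) (# 1) (≐-sym
      (≐-trans (neg-zero W) (≐-trans (canon-one _) (cong·₂ monus (add-one γ δ) (add-zero γ δ)))))
    ⊞ eqn (# 5 ⊕ # 2) (# 4 ⊕ # 3) (max-comm v u)
    ⊞ eqn (# 7 ⊕ # 9 ⊕ Sˡ 0ˡ ⊕ # 4) (# 6 ⊕ # 8 ⊕ # 14 ⊕ # 5) (max-comm q p)
    ⊞ eqn (# 11) (# 7) (neg-zero _)
    ⊞ eqn (# 13) (# 9) (neg-zero _)
    ⊞ eqn (# 6) (# 10) (≐-sym (pos-zero _))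
    ⊞ eqn (# 8) (# 12) (≐-sym (pos-zero _)))
  (# 0 ⊕ # 11 ⊕ # 13 ⊕ Sˡ 0ˡ) (# 1 ⊕ # 10 ⊕ # 12 ⊕ # 14) 0ˡ refl
  where
  W = (γ +ʀ δ) ʀ
  p q u v : Term _ ι
  p = addend₀ γ δ
  q = addend₁ γ δ
  u = p ∸̇ q
  v = q ∸̇ p

-- The hypothesis is used twice because approximations double. The resulting 2c cancels against the
-- -2c of the new digit, and the next carry remains.
addBound-suc : (γ δ : Term Γ 𝟏) (n : Term Γ ι) → Δ ⊢ addBound γ δ n → Δ ⊢ addBound γ δ (Ṡ n)
addBound-suc {Γ} {Δ} γ δ n ih = linarith
  (pos · W · n ∷ neg · W · n ∷ pos · W · Ṡ n ∷ neg · W · Ṡ n ∷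
   pos · (γ ʀ) · n ∷ neg · (γ ʀ) · n ∷ pos · (γ ʀ) · Ṡ n ∷ neg · (γ ʀ) · Ṡ n ∷
   pos · (δ ʀ) · n ∷ neg · (δ ʀ) · n ∷ pos · (δ ʀ) · Ṡ n ∷ neg · (δ ʀ) · Ṡ n ∷
   carries γ δ · n ∷ carries γ δ · Ṡ n ∷ sums γ δ · n ∷
   (γ ʀ) · Ṡ (Ṡ n) ∷ (δ ʀ) · Ṡ (Ṡ n) ∷ [])
  (le (# 0 ⊕ # 5 ⊕ # 9 ⊕ Sˡ 0ˡ) (# 1 ⊕ # 4 ⊕ # 8 ⊕ # 12) ih
    ⊞ le (# 0 ⊕ # 5 ⊕ # 9 ⊕ Sˡ 0ˡ) (# 1 ⊕ # 4 ⊕ # 8 ⊕ # 12) ih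
    ⊞ le (# 2 ⊕ (# 1 ⊕ # 1) ⊕ (# 12 ⊕ # 12) ⊕ Sˡ 0ˡ) (# 3 ⊕ (# 0 ⊕ # 0) ⊕ (# 14 ⊕ # 13))
      (add-suc-≤ γ δ n)
    ⊞ le (# 7 ⊕ (# 4 ⊕ # 4) ⊕ # 15) (# 6 ⊕ (# 5 ⊕ # 5) ⊕ Sˡ 0ˡ) (approx-suc-≥ γ n)
    ⊞ le (# 11 ⊕ (# 8 ⊕ # 8) ⊕ # 16) (# 10 ⊕ (# 9 ⊕ # 9) ⊕ Sˡ 0ˡ) (approx-suc-≥ δ n)
    ⊞ eqn (# 14) (# 15 ⊕ # 16) (sums-eq γ δ n))
  (# 2 ⊕ # 7 ⊕ # 11 ⊕ Sˡ 0ˡ) (# 3 ⊕ # 6 ⊕ # 10 ⊕ # 13) 0ˡ refl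
  where
  W : Term Γ 𝟏
  W = (γ +ʀ δ) ʀ

addition-≤ : (γ δ : Term Γ 𝟏) (n : Term Γ ι) → Δ ⊢ addBound γ δ n
addition-≤ γ δ n = inst lemma (n ∷ δ ∷ γ ∷ [])
  where
  lemma : Δ ⊢ ∀̇ 𝟏 (∀̇ 𝟏 (∀̇ ι (addBound v2 v1 v0)))
  lemma = ∀I (∀I (induct (addBound-zero v1 v0) (addBound-suc v2 v1 v0 h0)))

-- Nonnegativity of the distance

zero-digit : (n : Term Γ ι) → Δ ⊢ (0ʀ ʀ) · Ṡ (Ṡ n) ≐ 1̇
zero-digit n = compute (n ∷ []) ((0ʀ ʀ) · Ṡ (Ṡ v0)) 1̇ refl

+-≐0 : {s t : Term Γ ι} → Δ ⊢ s ≐ 0̇ → Δ ⊢ t ≐ 0̇ → Δ ⊢ s +̇ s +̇ t ≐ 0̇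
+-≐0 p q = ≐-trans (cong·₂ plus (cong·₂ plus p p) q) (conv refl)

pos-0ʀ : (n : Term Γ ι) → Δ ⊢ pos · (0ʀ ʀ) · n ≐ 0̇
pos-0ʀ n = inst lemma (n ∷ [])
  where
  lemma : Δ ⊢ ∀̇ ι (pos · (0ʀ ʀ) · v0 ≐ 0̇)
  lemma = induct (conv refl) (≐-trans (pos-suc (0ʀ ʀ) v0)
    (+-≐0 h0 (≐-trans (congᵗ (leq 2̇ v0) (zero-digit v0)) (conv refl))))

neg-0ʀ : (n : Term Γ ι) → Δ ⊢ neg · (0ʀ ʀ) · n ≐ 0̇
neg-0ʀ n = inst lemma (n ∷ [])
  where
  lemma : Δ ⊢ ∀̇ ι (neg · (0ʀ ʀ) · v0 ≐ 0̇)
  lemma = induct (conv refl) (≐-trans (neg-suc (0ʀ ʀ) v0)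
    (+-≐0 h0 (≐-trans (congᵗ (isZero v0) (zero-digit v0)) (conv refl))))

-- The total error 2 + 2 + 2 + 1: two units each from the triangle inequality, d(x, x) = 0 and
-- symmetry, and a transfer of at most 1 from the addition.
7̇ : Closed ι
7̇ = Ṡ (Ṡ (Ṡ (Ṡ (Ṡ 2̇))))

7ˡ : ∀ {n} → Lin n
7ˡ = Sˡ Sˡ Sˡ Sˡ Sˡ Sˡ Sˡ 0ˡ

-- From  0 = d (x, x) ≤ d (x, y) + d (y, x)  and symmetry.
d-nonneg-approx : (x y : Term Γ X) (n : Term Γ ι) →
  let a = pos · (d x y ʀ) · n ; b = neg · (d x y ʀ) · n in Δ ⊢ b +̇ b ≤̇ a +̇ a +̇ 7̇
d-nonneg-approx x y n = inst lemma (n ∷ y ∷ x ∷ [])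
  where
  lemma : Δ ⊢ ∀̇ X (∀̇ X (∀̇ ι (neg · (d v2 v1 ʀ) · v0 +̇ neg · (d v2 v1 ʀ) · v0 ≤̇
                              pos · (d v2 v1 ʀ) · v0 +̇ pos · (d v2 v1 ʀ) · v0 +̇ 7̇)))
  lemma = ∀I (∀I (∀I (linarith
    (pos · (d v2 v2 ʀ) · v0 ∷ neg · (d v2 v2 ʀ) · v0 ∷
     pos · ((d v2 v1 +ʀ d v1 v2) ʀ) · v0 ∷ neg · ((d v2 v1 +ʀ d v1 v2) ʀ) · v0 ∷
     pos · (d v2 v1 ʀ) · v0 ∷ neg · (d v2 v1 ʀ) · v0 ∷
     pos · (d v1 v2 ʀ) · v0 ∷ neg · (d v1 v2 ʀ) · v0 ∷
     pos · (0ʀ ʀ) · v0 ∷ neg · (0ʀ ʀ) · v0 ∷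
     carries (d v2 v1) (d v1 v2) · v0 ∷ [])
    (le (# 0 ⊕ # 3) (# 2 ⊕ # 1 ⊕ Sˡ Sˡ 0ˡ) (∀E (ax (base (d-tri v2 v1 v2))) v0)
      ⊞ le (# 8 ⊕ # 1) (# 0 ⊕ # 9 ⊕ Sˡ Sˡ 0ˡ) (∧E₂ (∀E (ax (base (d-refl v2))) v0))
      ⊞ le (# 6 ⊕ # 5) (# 4 ⊕ # 7 ⊕ Sˡ Sˡ 0ˡ) (∧E₂ (∀E (ax (base (d-sym v2 v1))) v0))
      ⊞ le (# 2 ⊕ # 5 ⊕ # 7 ⊕ Sˡ 0ˡ) (# 3 ⊕ # 4 ⊕ # 6 ⊕ # 10) (addition-≤ (d v2 v1) (d v1 v2) v0)
      ⊞ le (# 10) (Sˡ Sˡ 0ˡ) (carry-≤2 (d v2 v1) (d v1 v2) v0)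
      ⊞ eqn (# 9) 0ˡ (neg-0ʀ v0))
    (# 5 ⊕ # 5) (# 4 ⊕ # 4 ⊕ 7ˡ) (# 8) refl)))

-- A violation at stage n would double at stage n + 1.
d-nonneg : (x y : Term Γ X) (n : Term Γ ι) → Δ ⊢ leqAt (0ʀ ʀ) (d x y ʀ) n
d-nonneg x y n = ∨E (≤-total _ _) h0 (absurd (contradict h0))
  where
  D = d x y ʀ
  contradict : Δ ⊢ Ṡ (pos · D · n +̇ neg · (0ʀ ʀ) · n +̇ 2̇) ≤̇ pos · (0ʀ ʀ) · n +̇ neg · D · n →
               Δ ⊢ 1̇ ≤̇ 0̇
  -- The violation makes neg exceed pos by at least 3 at stage n, hence by at least 2 · 3 - 1 = 5 at
  -- stage n + 1. Doubled, this is 10, more than the admissible 7.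
  contradict {Δ} h = linarith ts
    (lower ⊞ lower ⊞ upper ⊞ upper ⊞ violation ⊞ violation ⊞ violation ⊞ violation
      ⊞ le (# 3 ⊕ # 3) (# 2 ⊕ # 2 ⊕ 7ˡ) (d-nonneg-approx x y (Ṡ n)))
    (Sˡ 0ˡ) 0ˡ (Sˡ Sˡ (# 5 ⊕ # 5 ⊕ # 7 ⊕ # 7 ⊕ # 7 ⊕ # 7)) refl
    where
    ts = pos · D · n ∷ neg · D · n ∷ pos · D · Ṡ n ∷ neg · D · Ṡ n ∷
         leq 2̇ (D · Ṡ (Ṡ n)) ∷ isZero (D · Ṡ (Ṡ n)) ∷
         pos · (0ʀ ʀ) · n ∷ neg · (0ʀ ʀ) · n ∷ []
    lower : Bound Δ ts (# 1 ⊕ # 1 ⊕ # 5) (# 3)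
    lower = eqn (# 1 ⊕ # 1 ⊕ # 5) (# 3) (≐-sym (neg-suc D n))
    upper : Bound Δ ts (# 2 ⊕ # 4) (# 0 ⊕ # 0 ⊕ # 4 ⊕ Sˡ 0ˡ)
    upper = eqn (# 2) (# 0 ⊕ # 0 ⊕ # 4) (pos-suc D n) ⊞ le (# 4) (Sˡ 0ˡ) (leq-≤1 2̇ _)
    violation : Bound Δ ts (Sˡ (# 0 ⊕ # 7 ⊕ Sˡ Sˡ 0ˡ) ⊕ # 6) (# 6 ⊕ # 1 ⊕ 0ˡ)
    violation = le (Sˡ (# 0 ⊕ # 7 ⊕ Sˡ Sˡ 0ˡ)) (# 6 ⊕ # 1) h ⊞ eqn (# 6) 0ˡ (pos-0ʀ n)

-- Leading digits of 1/(2^N + 1)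

pow-mono : (j i : Term Γ ι) → Δ ⊢ pow · j ≤̇ pow · (j +̇ i)
pow-mono j i = inst lemma (i ∷ j ∷ [])
  where
  lemma : Δ ⊢ ∀̇ ι (∀̇ ι (pow · v1 ≤̇ pow · (v1 +̇ v0)))
  lemma = ∀I (induct
    (linarith (pow · v0 ∷ pow · (v0 +̇ 0̇) ∷ []) (eqn (# 0) (# 1) (conv refl)) (# 0) (# 1) 0ˡ refl)
    (linarith (pow · v1 ∷ pow · (v1 +̇ v0) ∷ pow · (v1 +̇ Ṡ v0) ∷ [])
      (le (# 0) (# 1) h0 ⊞ eqn (# 1 ⊕ # 1) (# 2)
         (≐-sym (≐-trans (cong· pow (+-suc v1 v0)) (pow-suc _))))
      (# 0) (# 2) (# 1) refl))

branch-≤ : (z a b : Term Γ ι) → Δ ⊢ con rec · z · a · (con Π · (con Π · (a ∸̇ b))) ≤̇ a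
branch-≤ z a b = inst lemma (z ∷ b ∷ a ∷ [])
  where
  lemma : Δ ⊢ ∀̇ ι (∀̇ ι (∀̇ ι (con rec · v0 · v2 · (con Π · (con Π · (v2 ∸̇ v1))) ≤̇ v2)))
  lemma = ∀I (∀I (byCases
    (linarith (_ ∷ v1 ∷ []) (eqn (# 0) (# 1) (conv refl)) (# 0) (# 1) 0ˡ refl)
    (linarith (_ ∷ v2 ∷ v2 ∸̇ v1 ∷ [])
      (eqn (# 0) (# 2) (conv refl) ⊞ le (# 2) (# 1) (∸-≤ v2 v1)) (# 0) (# 1) 0ˡ refl)))

remainder-double : (r n : Term Γ ι) → let m = remainder · r · n in
                   Δ ⊢ remainder · r · Ṡ n ≤̇ m +̇ m
remainder-double r n = linarith (remainder · r · Ṡ n ∷ _ ∷ remainder · r · n ∷ [])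
  (eqn (# 0) (# 1) (remainder-suc r n) ⊞ le (# 1) (# 2 ⊕ # 2) (branch-≤ _ _ (Ṡ r)))
  (# 0) (# 2 ⊕ # 2) 0ˡ refl

-- The remainder starts at 1 and at most doubles in each step.
remainder-≤ : (r n : Term Γ ι) → Δ ⊢ remainder · r · n ≤̇ pow · n
remainder-≤ r n = inst lemma (n ∷ r ∷ [])
  where
  lemma : Δ ⊢ ∀̇ ι (∀̇ ι (remainder · v1 · v0 ≤̇ pow · v0))
  lemma = ∀I (induct (conv refl)
    (linarith (remainder · v1 · v0 ∷ remainder · v1 · Ṡ v0 ∷ pow · v0 ∷ pow · Ṡ v0 ∷ [])
      (le (# 0) (# 2) h0 ⊞ le (# 0) (# 2) h0 ⊞ le (# 1) (# 0 ⊕ # 0) (remainder-double v1 v0)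
        ⊞ eqn (# 2 ⊕ # 2) (# 3) (≐-sym (pow-suc v0)))
      (# 1) (# 3) 0ˡ refl))

recip-digit-small : (r n : Term Γ ι) → let m = remainder · r · n in
                    Δ ⊢ m +̇ m ≤̇ r → Δ ⊢ ((recip · r) ʀ) · Ṡ (Ṡ n) ≐ 1̇
recip-digit-small r n h = ≐-trans (recip-digit r n)
  -- `leq (Ṡ r) 2m ≐ 0̇` unfolds to the inequality 1 ≤ Ṡ r ∸ 2m, which `linarith` proves.
  (≐-trans (congᵗ (clip (1̇ +̇ v0)) (linarith
      (remainder · r · n ∷ r ∷ Ṡ r ∸̇ 2m ∷ 2m ∸̇ Ṡ r ∷ [])
      (le (# 0 ⊕ # 0) (# 1) h ⊞ eqn (Sˡ # 1 ⊕ # 3) (# 0 ⊕ # 0 ⊕ # 2) (max-comm (Ṡ r) 2m))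
      (Sˡ 0ˡ) (# 2) (# 3) refl))
    (conv refl))
  where
  2m = remainder · r · n +̇ remainder · r · n

-- For j < N the remainder satisfies 2ρ(j) ≤ 2^(j+1) ≤ 2^N < 2^N + 1, so the long division yields
-- only zero digits before stage N.
pos-recip-pow : (N k : Term Γ ι) → Δ ⊢ k ≤̇ N → Δ ⊢ pos · ((recip · (pow · N)) ʀ) · k ≐ 0̇
pos-recip-pow N k = ⇒E (inst lemma (k ∷ N ∷ []))
  where
  lemma : Δ ⊢ ∀̇ ι (∀̇ ι (v0 ≤̇ v1 ⇒̇ pos · ((recip · (pow · v1)) ʀ) · v0 ≐ 0̇))
  lemma = ∀I (induct (⇒I (≐-trans (pos-zero _) (recip-zero _)))
    (⇒I (≐-trans (pos-suc _ v0) (+-≐0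
      (⇒E h1 (linarith (v0 ∷ v1 ∷ []) (le (Sˡ # 0) (# 1) h0) (# 0) (# 1) (Sˡ 0ˡ) refl))
      (≐-trans (congᵗ (leq 2̇ v0) (recip-digit-small (pow · v1) v0
        (linarith (remainder · (pow · v1) · v0 ∷ pow · v0 ∷ pow · Ṡ v0 ∷
                   pow · (Ṡ v0 +̇ (v1 ∸̇ Ṡ v0)) ∷ pow · v1 ∷ [])
          (le (# 0) (# 1) (remainder-≤ _ v0) ⊞ le (# 0) (# 1) (remainder-≤ _ v0)
            ⊞ eqn (# 1 ⊕ # 1) (# 2) (≐-sym (pow-suc v0))
            ⊞ le (# 2) (# 3) (pow-mono _ _)
            ⊞ eqn (# 3) (# 4) (cong· pow (≤-elim h0)))
          (# 0 ⊕ # 0) (# 4) 0ˡ refl))) (conv refl))))))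

-- The positive part of the approximation to the reciprocal vanishes at stage k, and dropping its
-- negative part only weakens the inequality.
≤-recip-pow⇒≤0 : (γ : Term Γ 𝟏) (N k : Term Γ ι) → Δ ⊢ k ≤̇ N →
  Δ ⊢ leqAt (γ ʀ) ((recip · (pow · N)) ʀ) k → Δ ⊢ leqAt (γ ʀ) (0ʀ ʀ) k
≤-recip-pow⇒≤0 γ N k h p = linarith
  (pos · (γ ʀ) · k ∷ neg · (γ ʀ) · k ∷ pos · R · k ∷ neg · R · k ∷
   pos · (0ʀ ʀ) · k ∷ neg · (0ʀ ʀ) · k ∷ [])
  (le (# 0 ⊕ # 3) (# 2 ⊕ # 1 ⊕ Sˡ Sˡ 0ˡ) p
    ⊞ eqn (# 2) 0ˡ (pos-recip-pow N k h) ⊞ eqn (# 5) 0ˡ (neg-0ʀ k))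
  (# 0 ⊕ # 5) (# 4 ⊕ # 1 ⊕ Sˡ Sˡ 0ˡ) (# 3 ⊕ # 4) refl
  where
  R = (recip · (pow · N)) ʀ

-- Collection over X and the tail of the sequence

v6 : ∀ {Γ a b c d e f g} → Term (a ∷ b ∷ c ∷ d ∷ e ∷ f ∷ g ∷ Γ) g
v6 = wkᵗ v5

Params : Ctx
Params = X ∷ ι ∷ (ι ⇒ X) ∷ (X ⇒ X ⇒ 𝟏) ∷ (X ⇒ X) ∷ []

-- In the next two formulas  n = v0, y = v1, x = v2, k = v3, φ = v5, U = v6.
fixedAt closeAt : Formula (ι ∷ X ∷ Params)
fixedAt = leqAt (d (v6 · v1) v1 ʀ) (0ʀ ʀ) v0 ∧̇ leqAt (0ʀ ʀ) (d (v6 · v1) v1 ʀ) v0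
closeAt = ltAt ((v5 · v2 · v2) ʀ) ((v5 · v2 · v1 +ʀ 1/suc v3) ʀ) v0

-- A vacuous existential quantifier makes the bounded formula a Σ-formula.
witnessed : Formula (ι ∷ X ∷ Params)
witnessed = ∃̇ ι (wk (fixedAt ⇒̇ closeAt))

almostMinimal : Formula Params
almostMinimal = ∀∈Fix v4 (v4 · v1 · v1 <ʀ v4 · v1 · v0 +ʀ 1/suc v2)

pointwise-witness : Δ ⊢ almostMinimal → Δ ⊢ ∀̇ X (∃̇ ι witnessed)
-- The assumption is discharged first, so that `∀I` weakens it as a hypothesis. Its instance at y
-- has the form ∀ n `fixedAt` → ∃ n `closeAt`.
pointwise-witness = ⇒E (⇒I (∀I (independence-of-premise {A = fixedAt} {B = closeAt} (∀E h0 v0))))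

uniform-witness : Δ ⊢ almostMinimal → Δ ⊢ ∃̇ ι (∀̇ X (∃≤ v1 (ren skip₂ witnessed)))
uniform-witness p = ⇒E (ax (bColl-X witnessed (ex (imp (and atom atom) atom)))) (pointwise-witness p)

proposition4p2 : TM⁺ ∣ [] {A = Formula []} ⊢
    ∀̇ (X ⇒ X) (∀̇ (X ⇒ X ⇒ 𝟏) (∀̇ (ι ⇒ X) (
    ∀̇ ι (∃̇ ι (∀≥ v0 (
    d (v5 · (v3 · v0)) (v3 · v0) ≤ʀ 1/suc v2)))
    ⇒̇
    ∀̇ ι (∃∈Fix v3 (∀∈Fix v4 (
    v4 · v1 · v1 <ʀ v4 · v1 · v0 +ʀ 1/suc v2)))
    ⇒̇
    ∀̇ ι (∃∈Fix v3 (∃̇ ι (∀≥ v0 (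
    v5 · v2 · v2 <ʀ v5 · v2 · (v4 · v0) +ʀ 1/suc v3)))))))
proposition4p2 = ∀I (∀I (∀I (⇒I (⇒I (∀I
  (∃E (∀E h0 v0)
    (∃E (uniform-witness (∧E₂ h0))
      -- With N = `v0` from collection, r = 2^N gives the precision 1/(2^N + 1). It is chosen before
      -- m, so one starting index serves all later m.
      (∃E (∀E h3 (pow · v0))
        (∃I v2 (∧I (∧E₁ h2) (∃I v0 (∀I (⇒I
          -- The uniform bound is applied to y = u_m, which may lie outside F.
          (∃E (∀E h2 (v5 · v0))
            (∃E (∧E₂ h0)
              (∃I v1 (⇒E h0 (∧I
                -- Here `v1` is the n ≤ N found for u_m, `v2` is m and `v4` is N; only stage n of
                -- the bound on d(U(u_m), u_m) enters.
                (≤-recip-pow⇒≤0 _ v4 v1 (∧E₁ h1) (∀E (⇒E (∀E h3 v2) h2) v1))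
                (d-nonneg _ _ v1)))))))))))))))))))
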